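{- Let $k,s\ge 2$ be integers. Then there exists a constant $C_{s,k}$ such that for every positive integer $n$, $$\mathrm{ex}^*(n,C_{2k},s)\le C_{s,k}\,n^{1+1/k}.$$
   Context: $C_{2k}$ denotes the cycle of length $2k$. For a graph $H$ and positive integers $n,s$, $\mathrm{ex}^*(n,H,s)$ denotes the maximum number of edges in an $n$-vertex graph which contains no copy of $K_{s,s}$ as a (not necessarily induced) subgraph and contains no induced subgraph isomorphic to $H$. -}

module Defs where

open import Data.Nat using (ℕ; zero; suc; _<ᵇ_; _≡ᵇ_)
open import Data.Bool using (Bool; true; false; _∧_; _∨_)
open import Data.Fin using (Fin; toℕ)
open import Data.List using (List; allFin; concatMap; map; filterᵇ; length)
open import Data.Product using (_×_; _,_; Σ-syntax; ∃-syntax)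
open import Relation.Binary.PropositionalEquality using (_≡_; _≢_)
open import Function.Definitions using (Injective)

record Graph (n : ℕ) : Set where
  field
    adj    : Fin n → Fin n → Bool
    sym    : ∀ i j → adj i j ≡ adj j i
    irrefl : ∀ i → adj i i ≡ false
open Graph public

edges : {n : ℕ} → Graph n → ℕ
edges {n} G =
  length (filterᵇ (λ p → (toℕ (Data.Product.proj₁ p) <ᵇ toℕ (Data.Product.proj₂ p))
                         ∧ adj G (Data.Product.proj₁ p) (Data.Product.proj₂ p))
                  (concatMap (λ i → map (λ j → (i , j)) (allFin n)) (allFin n)))

ContainsKss : {n : ℕ} → ℕ → Graph n → Set
ContainsKss {n} s G =
  Σ[ f ∈ (Fin s → Fin n) ] Σ[ g ∈ (Fin s → Fin n) ]
    (Injective _≡_ _≡_ f × Injective _≡_ _≡_ g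
     × (∀ a b → f a ≢ g b)
     × (∀ a b → adj G (f a) (g b) ≡ true))

-- Adjacency of the cycle C_m on vertices 0,…,m-1 (used for m ≥ 3).
cycAdj : (m : ℕ) → Fin m → Fin m → Bool
cycAdj m i j =
  (suc (toℕ i) ≡ᵇ toℕ j) ∨ (suc (toℕ j) ≡ᵇ toℕ i)
  ∨ ((toℕ i ≡ᵇ 0) ∧ (suc (toℕ j) ≡ᵇ m))
  ∨ ((toℕ j ≡ᵇ 0) ∧ (suc (toℕ i) ≡ᵇ m))

ContainsInducedCycle : {n : ℕ} → ℕ → Graph n → Set
ContainsInducedCycle {n} m G =
  Σ[ h ∈ (Fin m → Fin n) ]
    (Injective _≡_ _≡_ h × (∀ i j → adj G (h i) (h j) ≡ cycAdj m i j))

{-# OPTIONS --safe #-}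
module Submission where

-- Pass to a vertex set σ of minimum degree at least δ and give each of its vertices the weight
-- w = D / degree, so that the closed walks of length 2j carry total weight D^(2j) tr P^(2j), P being the
-- transition operator of the simple random walk on σ. Its top eigenvalue is 1 and its moments are
-- log-convex, hence if δ^k is much larger than n, then tr P^(2k) is much larger than tr P^(2k-2) / δ.
-- A random closed walk of length 2k is a pair of independent walks of length k with common end points.
-- Two of its vertices c and d at distance at least 2 can be arranged to lie on different walks, d being a
-- first vertex. By AM-GM they coincide with probability small in terms of the probability that both walks
-- begin alike, which is at most tr P^(2k-2) / (δ tr P^(2k)). The Kővári–Sós–Turán argument, for the
-- distributions of c and d on the vertex set, then bounds the probability that c and d are adjacent
-- by probabilities of coincidence. So some closed walk has distinct vertices and no chord.

open import Defs
open import Data.Bool using (Bool; true; false; _∧_; _∨_; not)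
open import Data.Bool.Properties
  using (∧-conicalˡ; ∧-conicalʳ; ∨-comm; ∨-zeroʳ; T-≡) renaming (_≟_ to _≟ᵇ_)
open import Data.Empty using (⊥-elim)
open import Data.Fin using (Fin; zero; suc; toℕ)
open import Data.Fin.Properties using (any?; toℕ<n; toℕ-injective) renaming (suc-injective to Fin-suc-injective)
open import Data.List using (List; map; concatMap; filterᵇ; length; tabulate; allFin)
open import Data.List.Properties using (length-++; filter-++)
open import Data.Nat
open import Data.Nat.DivMod using (m%n<n; m≡m%n+[m/n]*n)
open import Data.Nat.Divisibility using (_∣_; divides; m∣m*n; ∣-trans; m≤n⇒m!∣n!)
open import Data.Nat.Properties
open import Data.Nat.Tactic.RingSolver using (solve-∀)
open import Data.Product using (∃-syntax; Σ-syntax; _×_; _,_; proj₁; proj₂)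
open import Data.Sum using (_⊎_; inj₁; inj₂)
open import Data.Vec using (Vec; []; _∷_; lookup)
open import Function using (_∘_; it)
open import Function.Bundles using (Equivalence)
open import Function.Definitions using (Injective)
open import Relation.Nullary using (¬_; yes; no; contradiction)
open import Relation.Nullary.Decidable using (_×-dec_; T?)
open import Relation.Binary.Definitions using (tri<; tri≈; tri>)
open import Relation.Binary.PropositionalEquality
  using (_≡_; _≢_; refl; cong; cong₂; subst; subst₂; trans; module ≡-Reasoning)
  renaming (sym to ≡-sym)
open import Algebra.Properties.Semiring.Sum +-*-semiring
  using (sum; sum-cong-≗; *-distribˡ-sum; *-distribʳ-sum; ∑-distrib-+; ∑-comm)

-- Inverse degree weights make regularity of `G` dispensable. The eigenvalue 1 of P is there
-- whatever the degrees are, so tr P^(2k) ≥ 1, while the minimum degree alone gives tr P^2 ≤ n / δ.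
-- If all k - 1 ratios from tr P^2 up to tr P^(2k) were at most K / δ, then 1 ≤ (K / δ)^(k-1) n / δ,
-- so δ^k ≤ K^(k-1) n. As the ratios increase, it is the last one that has to be large. The marked
-- vertices play unequal roles. Agreement of two walks in their first step is controlled by the
-- local weight at one vertex, whence the position of d. The position of c is arbitrary, and
-- agreement there has no such direct control. But two walks that meet in c at the same position can
-- be regrouped into a closed walk of the same length that visits c twice, and the bound for
-- coincidences applies to it. The argument stays in the natural numbers: probabilities are
-- unnormalised sums, quotients are multipliers on the two sides of an inequality, and square roots
-- are avoided by free multipliers in AM-GM.

private variable
  n m : ℕ

-- Finite sums of natural numbers

⟦_⟧ : Bool → ℕ
⟦ true ⟧ = 1
⟦ false ⟧ = 0

⟦⟧-idem : ∀ b → ⟦ b ⟧ * ⟦ b ⟧ ≡ ⟦ b ⟧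
⟦⟧-idem true = refl
⟦⟧-idem false = refl

⟦⟧≤1 : ∀ b → ⟦ b ⟧ ≤ 1
⟦⟧≤1 true = ≤-refl
⟦⟧≤1 false = z≤n

sum-mono : {f g : Fin n → ℕ} → (∀ i → f i ≤ g i) → sum f ≤ sum g
sum-mono {n = zero} f≤g = z≤n
sum-mono {n = suc n} f≤g = +-mono-≤ (f≤g zero) (sum-mono (f≤g ∘ suc))

term≤sum : (f : Fin n → ℕ) (i : Fin n) → f i ≤ sum f
term≤sum f zero = m≤m+n _ _
term≤sum f (suc i) = ≤-trans (term≤sum (f ∘ suc) i) (m≤n+m _ _)

sum-const : ∀ n c → sum {n} (λ _ → c) ≡ n * c
sum-const zero c = refl
sum-const (suc n) c = cong (c +_) (sum-const n c)

sum-positive : (f : Fin n → ℕ) → 0 < sum f → ∃[ i ] 0 < f i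
sum-positive {n = suc n} f 0<s with f zero in eq
... | suc x = zero , subst (0 <_) (≡-sym eq) z<s
... | zero with sum-positive (f ∘ suc) 0<s
...   | i , p = suc i , p

-- Recursive on both indices, in step with the recursion of `sum`, so that `sum-delta` is a plain
-- induction.
_==_ : Fin n → Fin n → Bool
zero == zero = true
zero == suc j = false
suc i == zero = false
suc i == suc j = i == j

==⇒≡ : (i j : Fin n) → (i == j) ≡ true → i ≡ j
==⇒≡ zero zero _ = refl
==⇒≡ (suc i) (suc j) p = cong suc (==⇒≡ i j p)

==-refl : (i : Fin n) → (i == i) ≡ true
==-refl zero = refl
==-refl (suc i) = ==-refl i

==-sym : (i j : Fin n) → (i == j) ≡ (j == i)
==-sym zero zero = refl
==-sym zero (suc j) = refl
==-sym (suc i) zero = refl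
==-sym (suc i) (suc j) = ==-sym i j

sum-delta : (f : Fin n → ℕ) (i : Fin n) → (sum λ j → f j * ⟦ i == j ⟧) ≡ f i
sum-delta {n = suc n} f zero = begin
  f zero * 1 + (sum λ j → f (suc j) * 0) ≡⟨ cong₂ _+_ (*-identityʳ (f zero)) (sum-cong-≗ λ j → *-zeroʳ (f (suc j))) ⟩
  f zero + (sum {n} λ _ → 0)             ≡⟨ cong (f zero +_) (trans (sum-const n 0) (*-zeroʳ n)) ⟩
  f zero + 0                             ≡⟨ +-identityʳ (f zero) ⟩
  f zero                                 ∎
  where open ≡-Reasoning
sum-delta {n = suc n} f (suc i) = cong₂ _+_ (*-zeroʳ (f zero)) (sum-delta (f ∘ suc) i)

sum-*-sum : (f : Fin m → ℕ) (g : Fin n → ℕ) → sum f * sum g ≡ sum λ i → sum λ j → f i * g j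
sum-*-sum f g = trans (*-distribʳ-sum (sum g) f) (sum-cong-≗ λ i → *-distribˡ-sum (f i) g)

-- Stands in for Cauchy-Schwarz: applied to multiples of `x` and `y`, with the multipliers chosen to
-- suit, it gives the same information without roots.
am-gm : ∀ x y → 2 * (x * y) ≤ x * x + y * y
am-gm x y with ≤-total x y
... | inj₁ x≤y = subst (λ y → 2 * (x * y) ≤ x * x + y * y) (m+[n∸m]≡n x≤y)
      (≤-trans (m≤m+n _ ((y ∸ x) * (y ∸ x))) (≤-reflexive (expand x (y ∸ x))))
  where
  expand : ∀ x d → 2 * (x * (x + d)) + d * d ≡ x * x + (x + d) * (x + d)
  expand = solve-∀
... | inj₂ y≤x = subst (λ x → 2 * (x * y) ≤ x * x + y * y) (m+[n∸m]≡n y≤x)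
      (≤-trans (m≤m+n _ ((x ∸ y) * (x ∸ y))) (≤-reflexive (expand y (x ∸ y))))
  where
  expand : ∀ y d → 2 * ((y + d) * y) + d * d ≡ (y + d) * (y + d) + y * y
  expand = solve-∀

^-distribʳ-* : ∀ o x y → (x * y) ^ o ≡ x ^ o * y ^ o
^-distribʳ-* zero x y = refl
^-distribʳ-* (suc o) x y = trans (cong (x * y *_) (^-distribʳ-* o x y)) (interchange x y (x ^ o) (y ^ o))
  where
  interchange : ∀ p q r s → p * q * (r * s) ≡ p * r * (q * s)
  interchange = solve-∀

-- Weighted walks and the log-convexity of their moments

module Walks {n : ℕ} (G : Graph n) (w : Fin n → ℕ) where

  A : Fin n → Fin n → ℕ
  A a b = ⟦ adj G a b ⟧

  A-sym : ∀ a b → A a b ≡ A b a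
  A-sym a b = cong ⟦_⟧ (sym G a b)

  -- ℓ is the number of interior vertices of a walk; the end points contribute no weight.
  h : ℕ → Fin n → Fin n → ℕ
  h zero a b = A a b
  h (suc ℓ) a b = sum λ c → A a c * w c * h ℓ c b

  -- Chapman-Kolmogorov. The `suc` counts the vertex `c` at which the walk is cut.
  h-+ : ∀ i j a b → h (suc (i + j)) a b ≡ sum λ c → h i a c * w c * h j c b
  h-+ zero j a b = refl
  h-+ (suc i) j a b = begin
    (sum λ d → A a d * w d * h (suc (i + j)) d b)
      ≡⟨ sum-cong-≗ (λ d → cong (A a d * w d *_) (h-+ i j d b)) ⟩
    (sum λ d → A a d * w d * sum λ c → h i d c * w c * h j c b)
      ≡⟨ sum-cong-≗ (λ d → *-distribˡ-sum (A a d * w d) λ c → h i d c * w c * h j c b) ⟩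
    (sum λ d → sum λ c → A a d * w d * (h i d c * w c * h j c b))
      ≡⟨ ∑-comm (λ d c → A a d * w d * (h i d c * w c * h j c b)) ⟩
    (sum λ c → sum λ d → A a d * w d * (h i d c * w c * h j c b))
      ≡⟨ sum-cong-≗ (λ c → sum-cong-≗ λ d → assoc (A a d * w d) (h i d c) (w c) (h j c b)) ⟩
    (sum λ c → sum λ d → A a d * w d * h i d c * (w c * h j c b))
      ≡⟨ sum-cong-≗ (λ c → *-distribʳ-sum (w c * h j c b) λ d → A a d * w d * h i d c) ⟨
    (sum λ c → h (suc i) a c * (w c * h j c b))
      ≡⟨ sum-cong-≗ (λ c → *-assoc (h (suc i) a c) (w c) (h j c b)) ⟨
    (sum λ c → h (suc i) a c * w c * h j c b) ∎
    where
    open ≡-Reasoning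
    assoc : ∀ p q r s → p * (q * r * s) ≡ p * q * (r * s)
    assoc = solve-∀

  h-sym : ∀ ℓ a b → h ℓ a b ≡ h ℓ b a
  h-sym zero a b = A-sym a b
  h-sym (suc ℓ) a b = begin
    (sum λ c → A a c * w c * h ℓ c b) ≡⟨ sum-cong-≗ (λ c → cong₂ (λ x y → x * w c * y) (A-sym a c) (h-sym ℓ c b)) ⟩
    (sum λ c → A c a * w c * h ℓ b c) ≡⟨ sum-cong-≗ (λ c → rev (A c a) (w c) (h ℓ b c)) ⟩
    (sum λ c → h ℓ b c * w c * A c a) ≡⟨ h-+ ℓ 0 b a ⟨
    h (suc (ℓ + 0)) b a               ≡⟨ cong (λ i → h (suc i) b a) (+-identityʳ ℓ) ⟩
    h (suc ℓ) b a                     ∎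
    where
    open ≡-Reasoning
    rev : ∀ p q r → p * q * r ≡ r * q * p
    rev = solve-∀

  -- Restores the weights of the end points, which `h` leaves out.
  ∬ : (Fin n → Fin n → ℕ) → ℕ
  ∬ F = sum λ a → sum λ b → w a * w b * F a b

  ∬-cong : ∀ {F F′} → (∀ a b → F a b ≡ F′ a b) → ∬ F ≡ ∬ F′
  ∬-cong e = sum-cong-≗ λ a → sum-cong-≗ λ b → cong (w a * w b *_) (e a b)

  ∬-mono : ∀ {F F′} → (∀ a b → F a b ≤ F′ a b) → ∬ F ≤ ∬ F′
  ∬-mono e = sum-mono λ a → sum-mono λ b → *-monoʳ-≤ (w a * w b) (e a b)

  ∬-+ : ∀ F F′ → ∬ (λ a b → F a b + F′ a b) ≡ ∬ F + ∬ F′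
  ∬-+ F F′ = trans
    (sum-cong-≗ λ a → trans (sum-cong-≗ λ b → *-distribˡ-+ (w a * w b) (F a b) (F′ a b))
                            (∑-distrib-+ (λ b → w a * w b * F a b) (λ b → w a * w b * F′ a b)))
    (∑-distrib-+ (λ a → sum λ b → w a * w b * F a b) (λ a → sum λ b → w a * w b * F′ a b))

  ∬-* : ∀ x F → ∬ (λ a b → x * F a b) ≡ x * ∬ F
  ∬-* x F = begin
    (sum λ a → sum λ b → w a * w b * (x * F a b)) ≡⟨ sum-cong-≗ (λ a → sum-cong-≗ λ b → swap (w a * w b) x (F a b)) ⟩
    (sum λ a → sum λ b → x * (w a * w b * F a b)) ≡⟨ sum-cong-≗ (λ a → *-distribˡ-sum x λ b → w a * w b * F a b) ⟨
    (sum λ a → x * sum λ b → w a * w b * F a b)   ≡⟨ *-distribˡ-sum x (λ a → sum λ b → w a * w b * F a b) ⟨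
    x * ∬ F ∎
    where
    open ≡-Reasoning
    swap : ∀ p q r → p * (q * r) ≡ q * (p * r)
    swap = solve-∀

  -- closed walks of length m + 1
  closed : ℕ → ℕ
  closed m = sum λ a → w a * h m a a

  -- Reversing the way back makes both arcs run from `a` to `b`. With `i` and `j` equal, closed
  -- walks become pairs of walks with common end points.
  closed-+ : ∀ i j → closed (suc (i + j)) ≡ ∬ (λ a b → h i a b * h j a b)
  closed-+ i j = sum-cong-≗ λ a → begin
    w a * h (suc (i + j)) a a                     ≡⟨ cong (w a *_) (h-+ i j a a) ⟩
    w a * (sum λ b → h i a b * w b * h j b a)     ≡⟨ *-distribˡ-sum (w a) (λ b → h i a b * w b * h j b a) ⟩
    (sum λ b → w a * (h i a b * w b * h j b a))   ≡⟨ sum-cong-≗ (λ b → cong (λ x → w a * (h i a b * w b * x)) (h-sym j b a)) ⟩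
    (sum λ b → w a * (h i a b * w b * h j a b))   ≡⟨ sum-cong-≗ (λ b → arrange (w a) (h i a b) (w b) (h j a b)) ⟩
    (sum λ b → w a * w b * (h i a b * h j a b))   ∎
    where
    open ≡-Reasoning
    arrange : ∀ p q r s → p * (q * r * s) ≡ p * r * (q * s)
    arrange = solve-∀

  -- Closed walks of length 2j + 2. For w = D / degree on σ, and zero elsewhere, this is D^(2j+2) tr
  -- P^(2j+2).
  moment : ℕ → ℕ
  moment j = ∬ (λ a b → h j a b * h j a b)

  -- A trace depends only on the total length, so unequal halves can be rebalanced.
  moment-mixed : ∀ j → ∬ (λ a b → h j a b * h (2 + j) a b) ≡ moment (suc j)
  moment-mixed j = begin
    ∬ (λ a b → h j a b * h (2 + j) a b) ≡⟨ closed-+ j (2 + j) ⟨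
    closed (suc (j + (2 + j)))           ≡⟨ cong (closed ∘ suc) (+-suc j (suc j)) ⟩
    closed (suc (suc j + suc j))         ≡⟨ closed-+ (suc j) (suc j) ⟩
    moment (suc j)                       ∎
    where
    open ≡-Reasoning

  -- AM-GM for `μ * h j` and `ν * h (2 + j)`, whose mixed term is the moment between them. The free
  -- multipliers replace the square of the middle moment in the usual form of log-convexity.
  moment-log-convex : ∀ ν μ j → 2 * (μ * ν * moment (suc j)) ≤ μ * μ * moment j + ν * ν * moment (2 + j)
  moment-log-convex ν μ j = begin
    2 * (μ * ν * moment (suc j))
      ≡⟨ cong (λ x → 2 * (μ * ν * x)) (moment-mixed j) ⟨
    2 * (μ * ν * ∬ (λ a b → h j a b * h (2 + j) a b))
      ≡⟨ *-assoc 2 (μ * ν) (∬ λ a b → h j a b * h (2 + j) a b) ⟨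
    2 * (μ * ν) * ∬ (λ a b → h j a b * h (2 + j) a b)
      ≡⟨ ∬-* (2 * (μ * ν)) (λ a b → h j a b * h (2 + j) a b) ⟨
    ∬ (λ a b → 2 * (μ * ν) * (h j a b * h (2 + j) a b))
      ≤⟨ ∬-mono (λ a b → scaled (h j a b) (h (2 + j) a b)) ⟩
    ∬ (λ a b → μ * μ * (h j a b * h j a b) + ν * ν * (h (2 + j) a b * h (2 + j) a b))
      ≡⟨ ∬-+ (λ a b → μ * μ * (h j a b * h j a b)) (λ a b → ν * ν * (h (2 + j) a b * h (2 + j) a b)) ⟩
    ∬ (λ a b → μ * μ * (h j a b * h j a b)) + ∬ (λ a b → ν * ν * (h (2 + j) a b * h (2 + j) a b))
      ≡⟨ cong₂ _+_ (∬-* (μ * μ) (λ a b → h j a b * h j a b)) (∬-* (ν * ν) (λ a b → h (2 + j) a b * h (2 + j) a b)) ⟩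
    μ * μ * moment j + ν * ν * moment (2 + j) ∎
    where
    open ≤-Reasoning
    scaled : ∀ x y → 2 * (μ * ν) * (x * y) ≤ μ * μ * (x * x) + ν * ν * (y * y)
    scaled x y = subst₂ _≤_ (lhs μ ν x y) (rhs μ ν x y) (am-gm (μ * x) (ν * y))
      where
      lhs : ∀ μ l x y → 2 * ((μ * x) * (l * y)) ≡ 2 * (μ * l) * (x * y)
      lhs = solve-∀
      rhs : ∀ μ l x y → μ * x * (μ * x) + l * y * (l * y) ≡ μ * μ * (x * x) + l * l * (y * y)
      rhs = solve-∀

  -- Ratios of consecutive moments increase, so a small last ratio makes all of them small.
  moment-ratio : ∀ ν μ .{{_ : NonZero μ}} j → ν * moment (suc j) ≤ μ * moment j →
    ν ^ suc j * moment (suc j) ≤ μ ^ suc j * moment 0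
  moment-ratio ν μ zero r = subst₂ (λ x y → x * moment 1 ≤ y * moment 0) (≡-sym (*-identityʳ ν)) (≡-sym (*-identityʳ μ)) r
  moment-ratio ν μ (suc j) r = begin
    ν * ν ^ suc j * moment (2 + j)   ≡⟨ swap ν (ν ^ suc j) (moment (2 + j)) ⟩
    ν ^ suc j * (ν * moment (2 + j)) ≤⟨ *-monoʳ-≤ (ν ^ suc j) r ⟩
    ν ^ suc j * (μ * moment (suc j))  ≡⟨ swap′ (ν ^ suc j) μ (moment (suc j)) ⟩
    μ * (ν ^ suc j * moment (suc j))  ≤⟨ *-monoʳ-≤ μ (moment-ratio ν μ j previous) ⟩
    μ * (μ ^ suc j * moment 0)         ≡⟨ *-assoc μ (μ ^ suc j) (moment 0) ⟨
    μ * μ ^ suc j * moment 0           ∎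
    where
    open ≤-Reasoning
    swap : ∀ p q r → p * q * r ≡ q * (p * r)
    swap = solve-∀
    swap′ : ∀ p q r → p * (q * r) ≡ q * (p * r)
    swap′ = solve-∀
    x y z : ℕ
    x = moment j
    y = moment (suc j)
    z = moment (2 + j)
    double : ∀ μ l y → 2 * (μ * l * y) ≡ μ * (l * y) + l * (μ * y)
    double = solve-∀
    -- Log-convexity with the two constants of the ratio as multipliers: the hypothesis turns
    -- `ν * z` into `μ * y`, and one of the two copies of the middle moment cancels.
    cancelled : μ * (ν * y) + ν * (μ * y) ≤ μ * (μ * x) + ν * (μ * y)
    cancelled = begin
      μ * (ν * y) + ν * (μ * y)   ≡⟨ double μ ν y ⟨
      2 * (μ * ν * y)              ≤⟨ moment-log-convex ν μ j ⟩
      μ * μ * x + ν * ν * z       ≡⟨ cong₂ _+_ (*-assoc μ μ x) (*-assoc ν ν z) ⟩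
      μ * (μ * x) + ν * (ν * z)   ≤⟨ +-monoʳ-≤ (μ * (μ * x)) (*-monoʳ-≤ ν r) ⟩
      μ * (μ * x) + ν * (μ * y)    ∎
    previous : ν * y ≤ μ * x
    previous = *-cancelˡ-≤ μ (+-cancelʳ-≤ (ν * (μ * y)) _ _ cancelled)

-- Closed walks with two marked vertices

sum-swap₄ : ∀ {n} (f : Fin n → Fin n → Fin n → Fin n → ℕ) →
  (sum λ c → sum λ d → sum λ a → sum λ b → f a b c d) ≡ (sum λ a → sum λ b → sum λ c → sum λ d → f a b c d)
sum-swap₄ f = begin
  (sum λ c → sum λ d → sum λ a → sum λ b → f a b c d) ≡⟨ sum-cong-≗ (λ c → ∑-comm λ d a → sum λ b → f a b c d) ⟩
  (sum λ c → sum λ a → sum λ d → sum λ b → f a b c d) ≡⟨ ∑-comm (λ c a → sum λ d → sum λ b → f a b c d) ⟩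
  (sum λ a → sum λ c → sum λ d → sum λ b → f a b c d) ≡⟨ sum-cong-≗ (λ a → sum-cong-≗ λ c → ∑-comm λ d b → f a b c d) ⟩
  (sum λ a → sum λ c → sum λ b → sum λ d → f a b c d) ≡⟨ sum-cong-≗ (λ a → ∑-comm λ c b → sum λ d → f a b c d) ⟩
  (sum λ a → sum λ b → sum λ c → sum λ d → f a b c d) ∎
  where open ≡-Reasoning

module Pinched {n : ℕ} (G : Graph n) (w : Fin n → ℕ) where
  open Walks G w public

  -- closed walks with marked vertices c and d, the two arcs between them having i and j interior vertices
  pinched : (Fin n → Fin n → ℕ) → ℕ → ℕ → ℕ
  pinched R i j = ∬ λ c d → R c d * (h i c d * h j c d)

  -- For fixed `a` and `b`, the unnormalised distribution of the interior vertex preceded by `l`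
  -- others on a random walk from `a` to `b`.
  via : ℕ → ℕ → Fin n → Fin n → Fin n → ℕ
  via l i a b c = h l a c * w c * h i c b

  sum-via : ∀ l i a b → sum (via l i a b) ≡ h (suc (l + i)) a b
  sum-via l i a b = ≡-sym (h-+ l i a b)

  -- Cut the closed walk at a point a of one arc and a point b of the other: the two walks between a and b
  -- become independent, one of them passing through c and the other through d.
  pinched-split : ∀ R i j l p → pinched R (suc (p + i)) (suc (j + l)) ≡
    ∬ λ a b → sum λ c → sum λ d → R c d * (via l i a b c * via p j b a d)
  pinched-split R i j l p = begin
    (sum λ c → sum λ d → w c * w d * (R c d * (h (suc (p + i)) c d * h (suc (j + l)) c d)))
      ≡⟨ sum-cong-≗ (λ c → sum-cong-≗ λ d → expand c d) ⟩
    (sum λ c → sum λ d → sum λ a → sum λ b → w a * w b * (R c d * (via l i a b c * via p j b a d)))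
      ≡⟨ sum-swap₄ (λ a b c d → w a * w b * (R c d * (via l i a b c * via p j b a d))) ⟩
    (sum λ a → sum λ b → sum λ c → sum λ d → w a * w b * (R c d * (via l i a b c * via p j b a d)))
      ≡⟨ sum-cong-≗ (λ a → sum-cong-≗ λ b → trans
           (*-distribˡ-sum (w a * w b) λ c → sum λ d → R c d * (via l i a b c * via p j b a d))
           (sum-cong-≗ λ c → *-distribˡ-sum (w a * w b) λ d → R c d * (via l i a b c * via p j b a d))) ⟨
    (∬ λ a b → sum λ c → sum λ d → R c d * (via l i a b c * via p j b a d)) ∎
    where
    open ≡-Reasoning
    arrange : ∀ wa wb wc wd r hl hi hp hj → wc * wd * r * ((hj * wa * hl) * (hp * wb * hi)) ≡
      wa * wb * (r * ((hl * wc * hi) * (hp * wd * hj)))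
    arrange = solve-∀
    expand : ∀ c d → w c * w d * (R c d * (h (suc (p + i)) c d * h (suc (j + l)) c d)) ≡
      sum λ a → sum λ b → w a * w b * (R c d * (via l i a b c * via p j b a d))
    expand c d = begin
      w c * w d * (R c d * (h (suc (p + i)) c d * h (suc (j + l)) c d))
        ≡⟨ cong₂ (λ x y → w c * w d * (R c d * (x * y)))
             (trans (h-sym (suc (p + i)) c d) (h-+ p i d c)) (trans (h-sym (suc (j + l)) c d) (h-+ j l d c)) ⟩
      w c * w d * (R c d * (sum (via p i d c) * sum (via j l d c)))
        ≡⟨ comm (w c * w d) (R c d) (sum (via p i d c)) (sum (via j l d c)) ⟩
      w c * w d * R c d * (sum (via j l d c) * sum (via p i d c))
        ≡⟨ cong (w c * w d * R c d *_) (sum-*-sum (via j l d c) (via p i d c)) ⟩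
      w c * w d * R c d * (sum λ a → sum λ b → via j l d c a * via p i d c b)
        ≡⟨ *-distribˡ-sum (w c * w d * R c d) (λ a → sum λ b → via j l d c a * via p i d c b) ⟩
      (sum λ a → w c * w d * R c d * sum λ b → via j l d c a * via p i d c b)
        ≡⟨ sum-cong-≗ (λ a → *-distribˡ-sum (w c * w d * R c d) λ b → via j l d c a * via p i d c b) ⟩
      (sum λ a → sum λ b → w c * w d * R c d * (via j l d c a * via p i d c b))
        ≡⟨ sum-cong-≗ (λ a → sum-cong-≗ λ b → trans
             (cong₂ (λ x y → w c * w d * R c d * ((h j d a * w a * x) * (y * w b * h i b c))) (h-sym l a c) (h-sym p d b))
             (trans
             (cong₂ (λ x y → w c * w d * R c d * ((x * w a * h l c a) * (h p b d * w b * y))) (h-sym j d a) (h-sym i b c))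
             (trans (cong (λ x → w c * w d * R c d * ((h j a d * w a * x) * (h p b d * w b * h i c b))) (h-sym l c a))
             (trans (arrange (w a) (w b) (w c) (w d) (R c d) (h l a c) (h i c b) (h p b d) (h j a d))
             (cong (λ x → w a * w b * (R c d * (via l i a b c * (h p b d * w d * x)))) (h-sym j a d)))))) ⟩
      (sum λ a → sum λ b → w a * w b * (R c d * (via l i a b c * via p j b a d))) ∎
      where
      comm : ∀ p q x y → p * (q * (x * y)) ≡ p * q * (y * x)
      comm = solve-∀

  same : Fin n → Fin n → ℕ
  same c d = ⟦ c == d ⟧

  clash : Fin n → Fin n → ℕ
  clash c d = same c d + A c d

  pinched-same : ∀ i j → pinched same i j ≡ sum λ c → w c * w c * (h i c c * h j c c)
  pinched-same i j = sum-cong-≗ λ c → trans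
    (sum-cong-≗ λ d → arrange (w c * w d) ⟦ c == d ⟧ (h i c d * h j c d))
    (sum-delta (λ d → w c * w d * (h i c d * h j c d)) c)
    where
    arrange : ∀ x y z → x * (y * z) ≡ x * z * y
    arrange = solve-∀

  -- Two walks from `a` to `b` that meet in `c` at the same position form a figure eight: the halves
  -- between `a` and `c` close up to one loop at `c`, the halves between `c` and `b` to another.
  -- This turns the collision term for `c` into a coincidence on a closed walk.
  via-squares : ∀ l i → (∬ λ a b → sum λ c → via l i a b c * via l i a b c) ≡ pinched same (suc (l + l)) (suc (i + i))
  via-squares l i = begin
    (∬ λ a b → sum λ c → via l i a b c * via l i a b c)
      ≡⟨ sum-cong-≗ (λ a → trans (sum-cong-≗ λ b → *-distribˡ-sum (w a * w b) λ c → via l i a b c * via l i a b c)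
           (∑-comm λ b c → w a * w b * (via l i a b c * via l i a b c))) ⟩
    (sum λ a → sum λ c → sum λ b → w a * w b * (via l i a b c * via l i a b c))
      ≡⟨ ∑-comm (λ a c → sum λ b → w a * w b * (via l i a b c * via l i a b c)) ⟩
    (sum λ c → sum λ a → sum λ b → w a * w b * (via l i a b c * via l i a b c))
      ≡⟨ sum-cong-≗ factor ⟩
    (sum λ c → w c * w c * (h (suc (l + l)) c c * h (suc (i + i)) c c))
      ≡⟨ pinched-same (suc (l + l)) (suc (i + i)) ⟨
    pinched same (suc (l + l)) (suc (i + i)) ∎
    where
    open ≡-Reasoning
    arrange : ∀ wa wb wc x y → wa * wb * ((x * wc * y) * (x * wc * y)) ≡ wc * wc * ((x * wa * x) * (y * wb * y))
    arrange = solve-∀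
    factor : ∀ c → (sum λ a → sum λ b → w a * w b * (via l i a b c * via l i a b c)) ≡
      w c * w c * (h (suc (l + l)) c c * h (suc (i + i)) c c)
    factor c = begin
      (sum λ a → sum λ b → w a * w b * (via l i a b c * via l i a b c))
        ≡⟨ sum-cong-≗ (λ a → sum-cong-≗ λ b → arrange (w a) (w b) (w c) (h l a c) (h i c b)) ⟩
      (sum λ a → sum λ b → w c * w c * ((h l a c * w a * h l a c) * (h i c b * w b * h i c b)))
        ≡⟨ sum-cong-≗ (λ a → *-distribˡ-sum (w c * w c) λ b → (h l a c * w a * h l a c) * (h i c b * w b * h i c b)) ⟨
      (sum λ a → w c * w c * sum λ b → (h l a c * w a * h l a c) * (h i c b * w b * h i c b))
        ≡⟨ *-distribˡ-sum (w c * w c) (λ a → sum λ b → (h l a c * w a * h l a c) * (h i c b * w b * h i c b)) ⟨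
      w c * w c * (sum λ a → sum λ b → (h l a c * w a * h l a c) * (h i c b * w b * h i c b))
        ≡⟨ cong (w c * w c *_) (sum-*-sum (λ a → h l a c * w a * h l a c) (λ b → h i c b * w b * h i c b)) ⟨
      w c * w c * ((sum λ a → h l a c * w a * h l a c) * (sum λ b → h i c b * w b * h i c b))
        ≡⟨ cong₂ (λ x y → w c * w c * (x * y))
             (trans (sum-cong-≗ λ a → cong (λ x → x * w a * h l a c) (h-sym l a c)) (≡-sym (h-+ l l c c)))
             (trans (sum-cong-≗ λ b → cong (λ x → h i c b * w b * x) (h-sym i c b)) (≡-sym (h-+ i i c c))) ⟩
      w c * w c * (h (suc (l + l)) c c * h (suc (i + i)) c c) ∎

  -- pairs of walks from b to a that agree in their first step
  first-step : ℕ → ℕ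
  first-step ι = ∬ λ a b → sum λ d → via 0 ι b a d * via 0 ι b a d

  -- Without the shared step from `b` to `c`, what remains is a pair of walks between `c` and `a`,
  -- as in `moment ι`. The sum over `b` leaves only the local weight at `c`, since `A b c` is
  -- idempotent. Here `D` is any bound on δ times that weight; it becomes `D * D` for the random
  -- walk.
  first-step-bound : ∀ δ D → (∀ c → δ * (w c * sum λ b → A b c * w b) ≤ D) → ∀ ι → δ * first-step ι ≤ D * moment ι
  first-step-bound δ D degree ι = begin
    δ * first-step ι
      ≡⟨ cong (δ *_) (sum-cong-≗ λ a → trans (sum-cong-≗ λ b → *-distribˡ-sum (w a * w b) λ c → via 0 ι b a c * via 0 ι b a c)
           (∑-comm λ b c → w a * w b * (via 0 ι b a c * via 0 ι b a c))) ⟩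
    δ * (sum λ a → sum λ c → sum λ b → w a * w b * (via 0 ι b a c * via 0 ι b a c))
      ≡⟨ cong (δ *_) (sum-cong-≗ λ a → sum-cong-≗ λ c → factor a c) ⟩
    δ * (∬ λ a c → (w c * sum λ b → A b c * w b) * (h ι a c * h ι a c))
      ≡⟨ ∬-* δ (λ a c → (w c * sum λ b → A b c * w b) * (h ι a c * h ι a c)) ⟨
    (∬ λ a c → δ * ((w c * sum λ b → A b c * w b) * (h ι a c * h ι a c)))
      ≤⟨ ∬-mono (λ a c → subst (_≤ D * (h ι a c * h ι a c)) (*-assoc δ (w c * sum λ b → A b c * w b) (h ι a c * h ι a c))
           (*-monoˡ-≤ (h ι a c * h ι a c) (degree c))) ⟩
    (∬ λ a c → D * (h ι a c * h ι a c))
      ≡⟨ ∬-* D (λ a c → h ι a c * h ι a c) ⟩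
    D * moment ι ∎
    where
    open ≤-Reasoning
    arrange : ∀ wa wb wc x y → wa * wb * ((x * wc * y) * (x * wc * y)) ≡ wa * wc * (wc * (y * y)) * ((x * x) * wb)
    arrange = solve-∀
    collect : ∀ wa wc y s → wa * wc * (wc * y) * s ≡ wa * wc * ((wc * s) * y)
    collect = solve-∀
    factor : ∀ a c → (sum λ b → w a * w b * (via 0 ι b a c * via 0 ι b a c)) ≡
      w a * w c * ((w c * sum λ b → A b c * w b) * (h ι a c * h ι a c))
    factor a c = let H = h ι c a * h ι c a in begin-equality
      (sum λ b → w a * w b * (via 0 ι b a c * via 0 ι b a c))
        ≡⟨ sum-cong-≗ (λ b → arrange (w a) (w b) (w c) (A b c) (h ι c a)) ⟩
      (sum λ b → w a * w c * (w c * H) * ((A b c * A b c) * w b))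
        ≡⟨ sum-cong-≗ (λ b → cong (λ x → w a * w c * (w c * H) * (x * w b)) (⟦⟧-idem (adj G b c))) ⟩
      (sum λ b → w a * w c * (w c * H) * (A b c * w b))
        ≡⟨ *-distribˡ-sum (w a * w c * (w c * H)) (λ b → A b c * w b) ⟨
      w a * w c * (w c * H) * (sum λ b → A b c * w b)
        ≡⟨ collect (w a) (w c) H (sum λ b → A b c * w b) ⟩
      w a * w c * ((w c * sum λ b → A b c * w b) * H)
        ≡⟨ cong (λ x → w a * w c * ((w c * sum λ b → A b c * w b) * (x * x))) (h-sym ι c a) ⟩
      w a * w c * ((w c * sum λ b → A b c * w b) * (h ι a c * h ι a c)) ∎

-- Sums over tuples and their collisions

⟦∧⟧ : ∀ a b → ⟦ a ∧ b ⟧ ≡ ⟦ a ⟧ * ⟦ b ⟧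
⟦∧⟧ true b = ≡-sym (+-identityʳ ⟦ b ⟧)
⟦∧⟧ false b = refl

⟦⟧≡0⇒false : ∀ b → ⟦ b ⟧ ≡ 0 → b ≡ false
⟦⟧≡0⇒false false _ = refl

choose : (P : Fin n → Bool) → ∀ s → s ≤ sum (λ i → ⟦ P i ⟧) →
  Σ[ f ∈ (Fin s → Fin n) ] Injective _≡_ _≡_ f × (∀ i → P (f i) ≡ true)
choose P zero _ = (λ ()) , (λ { {()} }) , λ ()
choose {n = suc n} P (suc s) s≤ with P zero in P0
... | false = let f , f-inj , Pf = choose (P ∘ suc) (suc s) s≤ in
  suc ∘ f , (λ e → f-inj (Fin-suc-injective e)) , Pf
... | true = let f , f-inj , Pf = choose (P ∘ suc) s (s≤s⁻¹ s≤) in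
  (λ { zero → zero ; (suc i) → suc (f i) }) ,
  (λ { {zero} {zero} _ → refl ; {suc i} {suc j} e → cong suc (f-inj (Fin-suc-injective e)) }) ,
  λ { zero → P0 ; (suc i) → Pf i }

∑ⱽ : (m : ℕ) → (Vec (Fin n) m → ℕ) → ℕ
∑ⱽ zero F = F []
∑ⱽ (suc m) F = sum λ a → ∑ⱽ m λ v → F (a ∷ v)

∑ⱽ-cong : ∀ m {F F′ : Vec (Fin n) m → ℕ} → (∀ v → F v ≡ F′ v) → ∑ⱽ m F ≡ ∑ⱽ m F′
∑ⱽ-cong zero e = e []
∑ⱽ-cong (suc m) e = sum-cong-≗ λ a → ∑ⱽ-cong m λ v → e (a ∷ v)

∑ⱽ-mono : ∀ m {F F′ : Vec (Fin n) m → ℕ} → (∀ v → F v ≤ F′ v) → ∑ⱽ m F ≤ ∑ⱽ m F′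
∑ⱽ-mono zero e = e []
∑ⱽ-mono (suc m) e = sum-mono λ a → ∑ⱽ-mono m λ v → e (a ∷ v)

∑ⱽ-* : ∀ m x (F : Vec (Fin n) m → ℕ) → ∑ⱽ m (λ v → x * F v) ≡ x * ∑ⱽ m F
∑ⱽ-* zero x F = refl
∑ⱽ-* (suc m) x F = trans (sum-cong-≗ λ a → ∑ⱽ-* m x λ v → F (a ∷ v))
  (≡-sym (*-distribˡ-sum x λ a → ∑ⱽ m λ v → F (a ∷ v)))

∑ⱽ-+ : ∀ m (F F′ : Vec (Fin n) m → ℕ) → ∑ⱽ m (λ v → F v + F′ v) ≡ ∑ⱽ m F + ∑ⱽ m F′
∑ⱽ-+ zero F F′ = refl
∑ⱽ-+ (suc m) F F′ = trans (sum-cong-≗ λ a → ∑ⱽ-+ m (λ v → F (a ∷ v)) (λ v → F′ (a ∷ v)))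
  (∑-distrib-+ (λ a → ∑ⱽ m λ v → F (a ∷ v)) (λ a → ∑ⱽ m λ v → F′ (a ∷ v)))

∑ⱽ-sum : ∀ m {k} (F : Vec (Fin n) m → Fin k → ℕ) → ∑ⱽ m (λ v → sum (F v)) ≡ sum λ d → ∑ⱽ m λ v → F v d
∑ⱽ-sum zero F = refl
∑ⱽ-sum (suc m) F = trans (sum-cong-≗ λ a → ∑ⱽ-sum m λ v → F (a ∷ v))
  (∑-comm λ a d → ∑ⱽ m λ v → F (a ∷ v) d)

∏ : (Fin n → ℕ) → Vec (Fin n) m → ℕ
∏ z [] = 1
∏ z (c ∷ t) = z c * ∏ z t

∏-* : (f g : Fin n → ℕ) (t : Vec (Fin n) m) → ∏ (λ c → f c * g c) t ≡ ∏ f t * ∏ g t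
∏-* f g [] = refl
∏-* f g (c ∷ t) = trans (cong (f c * g c *_) (∏-* f g t)) (interchange (f c) (g c) (∏ f t) (∏ g t))
  where
  interchange : ∀ p q r s → p * q * (r * s) ≡ p * r * (q * s)
  interchange = solve-∀

∑ⱽ-∏ : ∀ m (z : Fin n → ℕ) → ∑ⱽ m (∏ z) ≡ sum z ^ m
∑ⱽ-∏ zero z = refl
∑ⱽ-∏ (suc m) z = begin
  (sum λ c → ∑ⱽ m λ t → z c * ∏ z t) ≡⟨ sum-cong-≗ (λ c → trans (∑ⱽ-* m (z c) (∏ z)) (cong (z c *_) (∑ⱽ-∏ m z))) ⟩
  (sum λ c → z c * sum z ^ m)        ≡⟨ *-distribʳ-sum (sum z ^ m) z ⟨
  sum z * sum z ^ m                  ∎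
  where open ≡-Reasoning

multiplicity : Fin n → Vec (Fin n) m → ℕ
multiplicity c [] = 0
multiplicity c (d ∷ t) = ⟦ c == d ⟧ + multiplicity c t

-- Counts the pairs of positions with equal entries instead of merely testing for one, so that its
-- expectation is computed by linearity.
collisions : Vec (Fin n) m → ℕ
collisions [] = 0
collisions (c ∷ t) = multiplicity c t + collisions t

multiplicity≡0 : ∀ (c : Fin n) (t : Vec (Fin n) m) → multiplicity c t ≡ 0 → ∀ i → c ≢ lookup t i
multiplicity≡0 c (d ∷ t) e zero refl rewrite ==-refl c = contradiction e λ ()
multiplicity≡0 c (d ∷ t) e (suc i) = multiplicity≡0 c t (m+n≡0⇒n≡0 ⟦ c == d ⟧ e) i

lookup-injective : ∀ (t : Vec (Fin n) m) → collisions t ≡ 0 → Injective _≡_ _≡_ (lookup t)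
lookup-injective (c ∷ t) e {zero} {zero} _ = refl
lookup-injective (c ∷ t) e {zero} {suc j} p = contradiction p (multiplicity≡0 c t (m+n≡0⇒m≡0 _ e) j)
lookup-injective (c ∷ t) e {suc i} {zero} p = contradiction (≡-sym p) (multiplicity≡0 c t (m+n≡0⇒m≡0 _ e) i)
lookup-injective (c ∷ t) e {suc i} {suc j} p =
  cong suc (lookup-injective t (m+n≡0⇒n≡0 (multiplicity c t) e) p)

module _ (z : Fin n → ℕ) where
  private
    N = sum z
    Z = sum λ c → z c * z c

  -- Among `m` independent samples from z / N the expected number of copies of `c` is m z(c) / N;
  -- the denominators are cleared.
  ∑ⱽ-multiplicity : ∀ m c → N * ∑ⱽ m (λ t → ∏ z t * multiplicity c t) ≡ m * (z c * N ^ m)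
  ∑ⱽ-multiplicity zero c = *-zeroʳ N
  ∑ⱽ-multiplicity (suc m) c = begin
    N * (sum λ d → ∑ⱽ m λ t → z d * ∏ z t * (⟦ c == d ⟧ + multiplicity c t))
      ≡⟨ cong (N *_) (sum-cong-≗ λ d → trans (∑ⱽ-cong m λ t → expand (z d) (∏ z t) ⟦ c == d ⟧ (multiplicity c t))
           (trans (∑ⱽ-+ m (λ t → z d * ⟦ c == d ⟧ * ∏ z t) (λ t → z d * (∏ z t * multiplicity c t))) (cong₂ _+_
             (trans (∑ⱽ-* m (z d * ⟦ c == d ⟧) (∏ z)) (cong (z d * ⟦ c == d ⟧ *_) (∑ⱽ-∏ m z)))
             (∑ⱽ-* m (z d) (λ t → ∏ z t * multiplicity c t))))) ⟩
    N * (sum λ d → z d * ⟦ c == d ⟧ * N ^ m + z d * M)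
      ≡⟨ cong (N *_) (trans (∑-distrib-+ (λ d → z d * ⟦ c == d ⟧ * N ^ m) (λ d → z d * M)) (cong₂ _+_
           (trans (≡-sym (*-distribʳ-sum (N ^ m) λ d → z d * ⟦ c == d ⟧)) (cong (_* N ^ m) (sum-delta z c)))
           (≡-sym (*-distribʳ-sum M z)))) ⟩
    N * (z c * N ^ m + N * M)
      ≡⟨ cong (λ x → N * (z c * N ^ m + x)) (∑ⱽ-multiplicity m c) ⟩
    N * (z c * N ^ m + m * (z c * N ^ m))
      ≡⟨ collect N m (z c) (N ^ m) ⟩
    suc m * (z c * (N * N ^ m)) ∎
    where
    open ≡-Reasoning
    M = ∑ⱽ m λ t → ∏ z t * multiplicity c t
    expand : ∀ x p e q → x * p * (e + q) ≡ x * e * p + x * (p * q)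
    expand = solve-∀
    collect : ∀ N m x p → N * (x * p + m * (x * p)) ≡ x * (N * p) + m * (x * (N * p))
    collect = solve-∀

  -- Each pair of samples coincides with probability Z / N², and there are fewer than m² pairs; the
  -- square is a form that passes through the induction.
  ∑ⱽ-collisions : ∀ m → N * (N * ∑ⱽ m (λ t → ∏ z t * collisions t)) ≤ m * m * (Z * N ^ m)
  ∑ⱽ-collisions zero = ≤-reflexive (trans (cong (N *_) (*-zeroʳ N)) (*-zeroʳ N))
  ∑ⱽ-collisions (suc m) = begin
    N * (N * (sum λ c → ∑ⱽ m λ t → z c * ∏ z t * (multiplicity c t + collisions t)))
      ≡⟨ cong (λ x → N * (N * x)) (sum-cong-≗ λ c → trans (∑ⱽ-cong m λ t → expand (z c) (∏ z t) (multiplicity c t) (collisions t))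
           (trans (∑ⱽ-+ m (λ t → z c * (∏ z t * multiplicity c t)) (λ t → z c * (∏ z t * collisions t)))
             (cong₂ _+_ (∑ⱽ-* m (z c) λ t → ∏ z t * multiplicity c t) (∑ⱽ-* m (z c) λ t → ∏ z t * collisions t)))) ⟩
    N * (N * (sum λ c → z c * M c + z c * C))
      ≡⟨ cong (λ x → N * (N * x)) (trans (∑-distrib-+ (λ c → z c * M c) (λ c → z c * C)) (cong ((sum λ c → z c * M c) +_) (≡-sym (*-distribʳ-sum C z)))) ⟩
    N * (N * ((sum λ c → z c * M c) + N * C))
      ≡⟨ distribute N (sum λ c → z c * M c) C ⟩
    N * (N * (sum λ c → z c * M c)) + N * (N * (N * C))
      ≤⟨ +-mono-≤ (≤-reflexive (cong (N *_) first)) (*-monoʳ-≤ N (∑ⱽ-collisions m)) ⟩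
    N * (m * N ^ m * Z) + N * (m * m * (Z * N ^ m))
      -- The slack: (m + 1)² exceeds m² + m by m + 1.
      ≤⟨ m≤m+n _ (suc m * (N * N ^ m * Z)) ⟩
    N * (m * N ^ m * Z) + N * (m * m * (Z * N ^ m)) + suc m * (N * N ^ m * Z)
      ≡⟨ collect N m Z (N ^ m) ⟩
    suc m * suc m * (Z * (N * N ^ m)) ∎
    where
    open ≤-Reasoning
    M : Fin _ → ℕ
    M c = ∑ⱽ m λ t → ∏ z t * multiplicity c t
    C = ∑ⱽ m λ t → ∏ z t * collisions t
    expand : ∀ x p e q → x * p * (e + q) ≡ x * (p * e) + x * (p * q)
    expand = solve-∀
    distribute : ∀ N x y → N * (N * (x + N * y)) ≡ N * (N * x) + N * (N * (N * y))
    distribute = solve-∀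
    swap : ∀ p q r → p * (q * r) ≡ q * (p * r)
    swap = solve-∀
    arrange : ∀ x m p → x * (m * (x * p)) ≡ m * p * (x * x)
    arrange = solve-∀
    first : N * (sum λ c → z c * M c) ≡ m * N ^ m * Z
    first = begin-equality
      N * (sum λ c → z c * M c)          ≡⟨ *-distribˡ-sum N (λ c → z c * M c) ⟩
      (sum λ c → N * (z c * M c))        ≡⟨ sum-cong-≗ (λ c → trans (swap N (z c) (M c)) (cong (z c *_) (∑ⱽ-multiplicity m c))) ⟩
      (sum λ c → z c * (m * (z c * N ^ m))) ≡⟨ sum-cong-≗ (λ c → arrange (z c) m (N ^ m)) ⟩
      (sum λ c → m * N ^ m * (z c * z c)) ≡⟨ *-distribˡ-sum (m * N ^ m) (λ c → z c * z c) ⟨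
      m * N ^ m * Z                      ∎
    collect : ∀ N m Z p → N * (m * p * Z) + N * (m * m * (Z * p)) + (N * p * Z + m * (N * p * Z)) ≡ (1 + m) * (1 + m) * (Z * (N * p))
    collect = solve-∀

-- The Kővári-Sós-Turán argument for two distributions on the vertices

module KőváriSósTurán {n : ℕ} (G : Graph n) where

  private
    A : Fin n → Fin n → ℕ
    A a b = ⟦ adj G a b ⟧

  common : Vec (Fin n) m → Fin n → Bool
  common [] d = true
  common (c ∷ t) d = adj G c d ∧ common t d

  common-adj : ∀ (t : Vec (Fin n) m) {d} → common t d ≡ true → ∀ i → adj G (lookup t i) d ≡ true
  common-adj (c ∷ t) p zero = ∧-conicalˡ _ _ p
  common-adj (c ∷ t) p (suc i) = common-adj t (∧-conicalʳ _ _ p) i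

  ∏-common : ∀ (t : Vec (Fin n) m) d → ∏ (λ c → A c d) t ≡ ⟦ common t d ⟧
  ∏-common [] d = refl
  ∏-common (c ∷ t) d = trans (cong (A c d *_) (∏-common t d)) (≡-sym (⟦∧⟧ (adj G c d) (common t d)))

  -- Otherwise `s` common neighbours would be the second side of a forbidden subgraph; the sides are
  -- disjoint because `G` has no loops.
  few-common : ∀ s → ¬ ContainsKss s G → (t : Vec (Fin n) s) → collisions t ≡ 0 → sum (λ d → ⟦ common t d ⟧) ≤ s
  few-common s free t distinct with s ≤? sum (λ d → ⟦ common t d ⟧)
  ... | no s≰ = <⇒≤ (≰⇒> s≰)
  ... | yes s≤ = let g , g-inj , Pg = choose (common t) s s≤ in
    ⊥-elim (free (lookup t , g , lookup-injective t distinct , g-inj , disjoint {g} Pg , λ a b → common-adj t (Pg b) a))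
    where
    disjoint : ∀ {g : Fin s → Fin n} → (∀ i → common t (g i) ≡ true) → ∀ a b → lookup t a ≢ g b
    disjoint {g} Pg a b e with trans (≡-sym (common-adj t (Pg b) a)) (trans (cong (λ x → adj G x (g b)) e) (irrefl G (g b)))
    ... | ()

  -- `z` and `u` are the unnormalised distributions of c and d, both of mass `N`. Divided by N², the
  -- sums `Z` and `U` are the probabilities that two independent samples coincide, and `density` is
  -- the probability of adjacency.
  module _ (r : ℕ) (free : ¬ ContainsKss (suc r) G) (u z : Fin n → ℕ) (sum-u : sum u ≡ sum z) where
    private
      s = suc r
      N = sum z
      Z = sum λ c → z c * z c
      U = sum λ d → u d * u d

      f : Fin n → ℕ
      f d = sum λ c → z c * A c d

      g : Vec (Fin n) m → ℕ
      g t = sum λ d → u d * ⟦ common t d ⟧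

      density : ℕ
      density = sum λ c → sum λ d → A c d * (z c * u d)

    density-f : density ≡ sum λ d → u d * f d
    density-f = trans (∑-comm λ c d → A c d * (z c * u d)) (sum-cong-≗ λ d → trans
      (sum-cong-≗ λ c → arrange (A c d) (z c) (u d)) (≡-sym (*-distribˡ-sum (u d) λ c → z c * A c d)))
      where
      arrange : ∀ a z u → a * (z * u) ≡ u * (z * a)
      arrange = solve-∀

    -- The double count of stars: a centre `d` together with a tuple of its neighbours, summed in
    -- either order.
    power-f : ∀ m → (sum λ d → u d * f d ^ m) ≡ ∑ⱽ m λ t → ∏ z t * g t
    power-f m = begin
      (sum λ d → u d * f d ^ m)
        ≡⟨ sum-cong-≗ (λ d → cong (u d *_) (∑ⱽ-∏ m λ c → z c * A c d)) ⟨
      (sum λ d → u d * ∑ⱽ m (∏ λ c → z c * A c d))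
        ≡⟨ sum-cong-≗ (λ d → trans (cong (u d *_) (∑ⱽ-cong m λ t → trans (∏-* z (λ c → A c d) t) (cong (∏ z t *_) (∏-common t d))))
                                   (≡-sym (∑ⱽ-* m (u d) λ t → ∏ z t * ⟦ common t d ⟧))) ⟩
      (sum λ d → ∑ⱽ m λ t → u d * (∏ z t * ⟦ common t d ⟧))
        ≡⟨ ∑ⱽ-sum m (λ t d → u d * (∏ z t * ⟦ common t d ⟧)) ⟨
      ∑ⱽ m (λ t → sum λ d → u d * (∏ z t * ⟦ common t d ⟧))
        ≡⟨ ∑ⱽ-cong m (λ t → trans (sum-cong-≗ λ d → swap (u d) (∏ z t) ⟦ common t d ⟧)
                                  (≡-sym (*-distribˡ-sum (∏ z t) λ d → u d * ⟦ common t d ⟧))) ⟩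
      ∑ⱽ m (λ t → ∏ z t * g t) ∎
      where
      open ≡-Reasoning
      swap : ∀ p q r → p * (q * r) ≡ q * (p * r)
      swap = solve-∀

    -- At most `s` atoms of `u` contribute, and AM-GM trades each of them for its square:
    -- `y * N * u d` is at most `N * N + y * y * (u d * u d)`. The parameter `y` sets the rate of
    -- exchange.
    g-distinct : ∀ y (t : Vec (Fin n) s) → collisions t ≡ 0 → y * N * g t ≤ s * (N * N) + y * y * U
    g-distinct y t distinct = begin
      y * N * g t
        ≡⟨ *-distribˡ-sum (y * N) (λ d → u d * ⟦ common t d ⟧) ⟩
      (sum λ d → y * N * (u d * ⟦ common t d ⟧))
        ≤⟨ sum-mono (λ d → atom (common t d) (u d)) ⟩
      (sum λ d → ⟦ common t d ⟧ * (N * N) + y * y * (u d * u d))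
        ≡⟨ ∑-distrib-+ (λ d → ⟦ common t d ⟧ * (N * N)) (λ d → y * y * (u d * u d)) ⟩
      (sum λ d → ⟦ common t d ⟧ * (N * N)) + (sum λ d → y * y * (u d * u d))
        ≡⟨ cong₂ _+_ (*-distribʳ-sum (N * N) λ d → ⟦ common t d ⟧) (*-distribˡ-sum (y * y) λ d → u d * u d) ⟨
      (sum λ d → ⟦ common t d ⟧) * (N * N) + y * y * U
        ≤⟨ +-monoˡ-≤ (y * y * U) (*-monoˡ-≤ (N * N) (few-common s free t distinct)) ⟩
      s * (N * N) + y * y * U ∎
      where
      open ≤-Reasoning
      atom : ∀ b x → y * N * (x * ⟦ b ⟧) ≤ ⟦ b ⟧ * (N * N) + y * y * (x * x)
      atom false x = subst (_≤ y * y * (x * x)) (≡-sym (trans (cong (y * N *_) (*-zeroʳ x)) (*-zeroʳ (y * N)))) z≤n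
      atom true x = begin
        y * N * (x * 1)               ≡⟨ lhs y N x ⟩
        N * (y * x)                   ≤⟨ m≤m+n _ _ ⟩
        2 * (N * (y * x))             ≤⟨ am-gm N (y * x) ⟩
        N * N + y * x * (y * x)       ≡⟨ rhs y N x ⟩
        1 * (N * N) + y * y * (x * x) ∎
        where
        lhs : ∀ y N x → y * N * (x * 1) ≡ N * (y * x)
        lhs = solve-∀
        rhs : ∀ y N x → N * N + y * x * (y * x) ≡ 1 * (N * N) + y * y * (x * x)
        rhs = solve-∀

    g≤N : (t : Vec (Fin n) m) → g t ≤ N
    g≤N t = subst (g t ≤_) sum-u (sum-mono λ d →
      ≤-trans (*-monoʳ-≤ (u d) (⟦⟧≤1 (common t d))) (≤-reflexive (*-identityʳ (u d))))

    -- A tuple with repeated entries gets the trivial bound `g t ≤ N`, charged to its collisions;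
    -- the bound is then linear in `collisions t` and can be averaged.
    g-bound : ∀ y (t : Vec (Fin n) s) → y * N * g t ≤ s * (N * N) + y * y * U + y * (N * N) * collisions t
    g-bound y t with collisions t in eq
    ... | zero = ≤-trans (g-distinct y t eq) (m≤m+n _ _)
    ... | suc k = begin
      y * N * g t                   ≤⟨ *-monoʳ-≤ (y * N) (g≤N t) ⟩
      y * N * N                     ≡⟨ *-assoc y N N ⟩
      y * (N * N)                   ≤⟨ m≤m*n (y * (N * N)) (suc k) ⟩
      y * (N * N) * suc k           ≤⟨ m≤n+m _ _ ⟩
      s * (N * N) + y * y * U + y * (N * N) * suc k ∎
      where open ≤-Reasoning

    ∑-g-bound : ∀ y → y * N * ∑ⱽ s (λ t → ∏ z t * g t) ≤ N ^ s * (s * (N * N) + y * y * U + y * (s * s * Z))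
    ∑-g-bound y = begin
      y * N * ∑ⱽ s (λ t → ∏ z t * g t)
        ≡⟨ ∑ⱽ-* s (y * N) (λ t → ∏ z t * g t) ⟨
      ∑ⱽ s (λ t → y * N * (∏ z t * g t))
        ≤⟨ ∑ⱽ-mono s (λ t → ≤-trans (≤-reflexive (swap (y * N) (∏ z t) (g t))) (≤-trans (*-monoʳ-≤ (∏ z t) (g-bound y t))
             (≤-reflexive (expand (∏ z t) B (y * (N * N)) (collisions t))))) ⟩
      ∑ⱽ s (λ t → B * ∏ z t + y * (N * N) * (∏ z t * collisions t))
        ≡⟨ trans (∑ⱽ-+ s (λ t → B * ∏ z t) (λ t → y * (N * N) * (∏ z t * collisions t))) (cong₂ _+_
             (trans (∑ⱽ-* s B (∏ z)) (cong (B *_) (∑ⱽ-∏ s z))) (∑ⱽ-* s (y * (N * N)) λ t → ∏ z t * collisions t)) ⟩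
      B * N ^ s + y * (N * N) * ∑ⱽ s (λ t → ∏ z t * collisions t)
        ≡⟨ cong (B * N ^ s +_) (assoc y N (∑ⱽ s λ t → ∏ z t * collisions t)) ⟩
      B * N ^ s + y * (N * (N * ∑ⱽ s (λ t → ∏ z t * collisions t)))
        ≤⟨ +-monoʳ-≤ (B * N ^ s) (*-monoʳ-≤ y (∑ⱽ-collisions z s)) ⟩
      B * N ^ s + y * (s * s * (Z * N ^ s))
        ≡⟨ collect B (N ^ s) y (s * s) Z ⟩
      N ^ s * (B + y * (s * s * Z)) ∎
      where
      open ≤-Reasoning
      B = s * (N * N) + y * y * U
      swap : ∀ p q r → p * (q * r) ≡ q * (p * r)
      swap = solve-∀
      expand : ∀ p b q c → p * (b + q * c) ≡ b * p + q * (p * c)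
      expand = solve-∀
      assoc : ∀ y N c → y * (N * N) * c ≡ y * (N * (N * c))
      assoc = solve-∀
      collect : ∀ b p y q Z → b * p + y * (q * (Z * p)) ≡ p * (b + y * (q * Z))
      collect = solve-∀

    -- Convexity of x ↦ x ^ s in linear form: either x ≤ N / L, or (L x / N) ^ r ≥ 1.
    linearised-power : ∀ L x → L * x * N ^ r ≤ N ^ s + L ^ s * x ^ s
    linearised-power L x with ≤-total (L * x) N
    ... | inj₁ Lx≤N = ≤-trans (*-monoˡ-≤ (N ^ r) Lx≤N) (m≤m+n _ _)
    ... | inj₂ N≤Lx = begin
      L * x * N ^ r        ≤⟨ *-monoʳ-≤ (L * x) (^-monoˡ-≤ r N≤Lx) ⟩
      (L * x) ^ s          ≡⟨ ^-distribʳ-* s L x ⟩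
      L ^ s * x ^ s        ≤⟨ m≤n+m _ _ ⟩
      N ^ s + L ^ s * x ^ s ∎
      where open ≤-Reasoning

    -- Plays the part of Jensen's inequality for the `s`-th power: the linearised form is applied at
    -- every `d` and averaged against `u`.
    density-power : ∀ L → L * density * N ^ r ≤ N * N ^ s + L ^ s * ∑ⱽ s (λ t → ∏ z t * g t)
    density-power L = begin
      L * density * N ^ r
        ≡⟨ cong (λ x → L * x * N ^ r) density-f ⟩
      L * (sum λ d → u d * f d) * N ^ r
        ≡⟨ trans (swap L (sum λ d → u d * f d) (N ^ r)) (*-distribˡ-sum (L * N ^ r) λ d → u d * f d) ⟩
      (sum λ d → L * N ^ r * (u d * f d))
        ≤⟨ sum-mono (λ d → ≤-trans (≤-reflexive (arrange L (N ^ r) (u d) (f d))) (≤-trans (*-monoʳ-≤ (u d) (linearised-power L (f d)))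
             (≤-reflexive (expand (u d) (N ^ s) (L ^ s) (f d ^ s))))) ⟩
      (sum λ d → N ^ s * u d + L ^ s * (u d * f d ^ s))
        ≡⟨ trans (∑-distrib-+ (λ d → N ^ s * u d) (λ d → L ^ s * (u d * f d ^ s))) (cong₂ _+_
             (trans (≡-sym (*-distribˡ-sum (N ^ s) u)) (trans (cong (N ^ s *_) sum-u) (*-comm (N ^ s) N)))
             (trans (≡-sym (*-distribˡ-sum (L ^ s) λ d → u d * f d ^ s)) (cong (L ^ s *_) (power-f s)))) ⟩
      N * N ^ s + L ^ s * ∑ⱽ s (λ t → ∏ z t * g t) ∎
      where
      open ≤-Reasoning
      swap : ∀ p q r → p * q * r ≡ p * r * q
      swap = solve-∀
      arrange : ∀ l p u f → l * p * (u * f) ≡ u * (l * f * p)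
      arrange = solve-∀
      expand : ∀ u p l q → u * (p + l * q) ≡ p * u + l * (u * q)
      expand = solve-∀

    -- After division by L N², the probability of adjacency is at most 2 / L plus constant multiples
    -- of the two coincidence probabilities.
    density-bound-positive : ∀ L .{{_ : NonZero L}} .{{_ : NonZero N}} →
      L * density ≤ 2 * (N * N) + L ^ s * (L ^ s * s) * U + L ^ s * (s * s) * Z
    density-bound-positive L = *-cancelˡ-≤ (L ^ s * s) (*-cancelˡ-≤ (N ^ s) scaled)
      where
      open ≤-Reasoning
      instance
        nonZero₁ : NonZero (L ^ s)
        nonZero₁ = m^n≢0 L s
        nonZero₂ : NonZero (L ^ s * s)
        nonZero₂ = m*n≢0 (L ^ s) s
        nonZero₃ : NonZero (N ^ s)
        nonZero₃ = m^n≢0 N s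
      -- Chosen so that the main term `L ^ s * (s * (N * N))` of the tuples equals the term
      -- `y * (N * N)` of the linearisation; together they give the 2.
      y = L ^ s * s
      S = ∑ⱽ s λ t → ∏ z t * g t
      shift : ∀ p N y x → N * p * (y * x) ≡ y * N * (x * p)
      shift = solve-∀
      expand : ∀ y N p l S → y * N * (N * p + l * S) ≡ y * (N * N) * p + l * (y * N * S)
      expand = solve-∀
      collect : ∀ l s N p U Z → l * s * (N * N) * p + l * (p * (s * (N * N) + l * s * (l * s) * U + l * s * (s * s * Z))) ≡
        p * (l * s * (2 * (N * N) + l * (l * s) * U + l * (s * s) * Z))
      collect = solve-∀
      scaled : N ^ s * (y * (L * density)) ≤ N ^ s * (y * (2 * (N * N) + L ^ s * y * U + L ^ s * (s * s) * Z))
      scaled = begin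
        N * N ^ r * (y * (L * density))
          ≡⟨ shift (N ^ r) N y (L * density) ⟩
        y * N * (L * density * N ^ r)
          ≤⟨ *-monoʳ-≤ (y * N) (density-power L) ⟩
        y * N * (N * N ^ s + L ^ s * S)
          ≡⟨ expand y N (N ^ s) (L ^ s) S ⟩
        y * (N * N) * N ^ s + L ^ s * (y * N * S)
          ≤⟨ +-monoʳ-≤ (y * (N * N) * N ^ s) (*-monoʳ-≤ (L ^ s) (∑-g-bound y)) ⟩
        y * (N * N) * N ^ s + L ^ s * (N ^ s * (s * (N * N) + y * y * U + y * (s * s * Z)))
          ≡⟨ collect (L ^ s) s N (N ^ s) U Z ⟩
        N ^ s * (y * (2 * (N * N) + L ^ s * y * U + L ^ s * (s * s) * Z)) ∎

    density-bound : ∀ L .{{_ : NonZero L}} →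
      L * density ≤ 2 * (N * N) + L ^ s * (L ^ s * s) * U + L ^ s * (s * s) * Z
    density-bound L with N ≟ 0
    ... | no N≢0 = density-bound-positive L {{it}} {{≢-nonZero N≢0}}
    -- Without mass the density is zero, being at most `N * N`.
    ... | yes N≡0 = subst (_≤ 2 * (N * N) + L ^ s * (L ^ s * s) * U + L ^ s * (s * s) * Z)
      (≡-sym (trans (cong (L *_) (n≤0⇒n≡0 (subst (density ≤_) (cong (λ x → x * N) N≡0) density≤))) (*-zeroʳ L))) z≤n
      where
      density≤ : density ≤ N * N
      density≤ = ≤-trans
        (sum-mono λ c → sum-mono λ d → ≤-trans (*-monoˡ-≤ (z c * u d) (⟦⟧≤1 (adj G c d))) (≤-reflexive (+-identityʳ _)))
        (≤-reflexive (trans (≡-sym (sum-*-sum z u)) (cong (N *_) sum-u)))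

-- Bounds for coincidences and chords in closed walks

sum-squares≤ : (f : Fin n → ℕ) → (sum λ c → f c * f c) ≤ sum f * sum f
sum-squares≤ f = ≤-trans (sum-mono λ c → *-monoʳ-≤ (f c) (term≤sum f c)) (≤-reflexive (≡-sym (*-distribʳ-sum (sum f) f)))

module Bounds {n : ℕ} (G : Graph n) (w : Fin n → ℕ) (ι : ℕ) where
  open Pinched G w

  private
    T₀ = moment (suc ι)
    U = first-step ι

    opposite : ∀ {i j} → i + j ≡ ι + ι → i ≤ ι → j ≡ ι + (ι ∸ i)
    opposite {i} {j} i+j i≤ι = +-cancelˡ-≡ i j (ι + (ι ∸ i)) (begin
      i + j               ≡⟨ i+j ⟩
      ι + ι               ≡⟨ cong (ι +_) (m+[n∸m]≡n i≤ι) ⟨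
      ι + (i + (ι ∸ i))   ≡⟨ swap ι i (ι ∸ i) ⟩
      i + (ι + (ι ∸ i))   ∎)
      where
      open ≡-Reasoning
      swap : ∀ p q r → p + (q + r) ≡ q + (p + r)
      swap = solve-∀

  -- It suffices to consider marked vertices for which the shorter arc comes first.
  pinched-wlog : ∀ R B → (∀ i l → l + i ≡ ι → pinched R (suc i) (suc (ι + l)) ≤ B) →
    ∀ i j → i + j ≡ ι + ι → pinched R (suc i) (suc j) ≤ B
  pinched-wlog R B short i j i+j with ≤-total i ι
  ... | inj₁ i≤ι rewrite opposite i+j i≤ι = short i (ι ∸ i) (m∸n+n≡m i≤ι)
  ... | inj₂ ι≤i = subst (_≤ B) (∬-cong λ c d → cong (R c d *_) (*-comm (h (suc j) c d) (h (suc i) c d))) swapped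
    where
    j≤ι : j ≤ ι
    j≤ι = +-cancelˡ-≤ ι j ι (≤-trans (+-monoˡ-≤ j ι≤i) (≤-reflexive i+j))
    swapped : pinched R (suc j) (suc i) ≤ B
    swapped rewrite opposite (trans (+-comm j i) i+j) j≤ι = short j (ι ∸ j) (m∸n+n≡m j≤ι)

  -- AM-GM separates the walk of `c` from that of `d`. The part of `c` is at most `T₀`, as a sum of
  -- squares is at most the square of the sum; the part of `d` is `U`, as `d` is a first vertex.
  -- Putting the multiplier `L` on the second part turns smallness of `U` into the gain of a factor
  -- `L`.
  same-bound : ∀ L → L * L * U ≤ T₀ → ∀ i j → i + j ≡ ι + ι → L * pinched same (suc i) (suc j) ≤ T₀
  same-bound L small i j i+j = subst (_≤ T₀) (∬-* L _)
    (subst (_≤ T₀) (scale i j) (pinched-wlog (λ c d → L * same c d) T₀ short i j i+j))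
    where
    open ≤-Reasoning
    scale : ∀ i j → pinched (λ c d → L * same c d) (suc i) (suc j) ≡
      ∬ λ c d → L * (same c d * (h (suc i) c d * h (suc j) c d))
    scale i j = ∬-cong λ c d → *-assoc L (same c d) (h (suc i) c d * h (suc j) c d)
    short : ∀ i l → l + i ≡ ι → pinched (λ c d → L * same c d) (suc i) (suc (ι + l)) ≤ T₀
    short i l l+i = *-cancelˡ-≤ 2 (begin
      2 * pinched (λ c d → L * same c d) (suc i) (suc (ι + l))
        -- The 0 puts `d` right after `b`, and `l + i ≡ ι` gives both walks `suc ι` interior
        -- vertices.
        ≡⟨ cong (2 *_) (pinched-split (λ c d → L * same c d) i ι l 0) ⟩
      2 * (∬ λ a b → sum λ c → sum λ d → L * same c d * (x a b c * y a b d))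
        ≡⟨ ∬-* 2 (λ a b → sum λ c → sum λ d → L * same c d * (x a b c * y a b d)) ⟨
      (∬ λ a b → 2 * sum λ c → sum λ d → L * same c d * (x a b c * y a b d))
        ≤⟨ ∬-mono local ⟩
      (∬ λ a b → h (suc ι) a b * h (suc ι) a b + L * L * sum λ c → y a b c * y a b c)
        ≡⟨ trans (∬-+ (λ a b → h (suc ι) a b * h (suc ι) a b) (λ a b → L * L * sum λ c → y a b c * y a b c))
             (cong (T₀ +_) (∬-* (L * L) λ a b → sum λ c → y a b c * y a b c)) ⟩
      T₀ + L * L * U
        ≤⟨ +-monoʳ-≤ T₀ small ⟩
      T₀ + T₀
        ≡⟨ cong (T₀ +_) (+-identityʳ T₀) ⟨
      2 * T₀ ∎)
      where
      x y : Fin n → Fin n → Fin n → ℕ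
      x a b c = via l i a b c
      y a b d = via 0 ι b a d
      arrange : ∀ L e x y → L * e * (x * y) ≡ x * (L * y) * e
      arrange = solve-∀
      square : ∀ L y → L * y * (L * y) ≡ L * L * (y * y)
      square = solve-∀
      local : ∀ a b → 2 * (sum λ c → sum λ d → L * same c d * (x a b c * y a b d)) ≤
        h (suc ι) a b * h (suc ι) a b + L * L * sum λ c → y a b c * y a b c
      local a b = begin
        2 * (sum λ c → sum λ d → L * same c d * (x a b c * y a b d))
          ≡⟨ cong (2 *_) (sum-cong-≗ λ c → trans (sum-cong-≗ λ d → arrange L (same c d) (x a b c) (y a b d))
               (sum-delta (λ d → x a b c * (L * y a b d)) c)) ⟩
        2 * (sum λ c → x a b c * (L * y a b c))
          ≡⟨ *-distribˡ-sum 2 (λ c → x a b c * (L * y a b c)) ⟩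
        (sum λ c → 2 * (x a b c * (L * y a b c)))
          ≤⟨ sum-mono (λ c → am-gm (x a b c) (L * y a b c)) ⟩
        (sum λ c → x a b c * x a b c + L * y a b c * (L * y a b c))
          ≡⟨ trans (∑-distrib-+ (λ c → x a b c * x a b c) (λ c → L * y a b c * (L * y a b c))) (cong ((sum λ c → x a b c * x a b c) +_)
               (trans (sum-cong-≗ λ c → square L (y a b c)) (≡-sym (*-distribˡ-sum (L * L) λ c → y a b c * y a b c)))) ⟩
        (sum λ c → x a b c * x a b c) + L * L * (sum λ c → y a b c * y a b c)
          ≤⟨ +-monoˡ-≤ _ (sum-squares≤ (x a b)) ⟩
        sum (x a b) * sum (x a b) + L * L * (sum λ c → y a b c * y a b c)
          ≡⟨ cong (λ N → N * N + L * L * (sum λ c → y a b c * y a b c)) (trans (sum-via l i a b) (cong (λ k → h (suc k) a b) l+i)) ⟩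
        h (suc ι) a b * h (suc ι) a b + L * L * (sum λ c → y a b c * y a b c) ∎

  -- The assumptions serve, in this order, the coincidence of c with d, the collisions of d and the
  -- collisions of c. In the last one the coefficient is squared because it is the multiplier in
  -- `same-bound`.
  module _ (r : ℕ) (free : ¬ ContainsKss (suc r) G) (L : ℕ) .{{_ : NonZero L}}
    (small₁ : L * L * U ≤ T₀)
    (small₂ : L ^ suc r * (L ^ suc r * suc r) * U ≤ T₀)
    (small₃ : L ^ suc r * (suc r * suc r) * (L ^ suc r * (suc r * suc r)) * U ≤ T₀) where
    open KőváriSósTurán G
    private
      s = suc r
      c₁ = L ^ s * (L ^ s * s)
      c₂ = L ^ s * (s * s)

    -- `density-bound` is applied for each pair of end points and then integrated. The collisions of
    -- d add up to `U`. Those of c add up to figure eights, whose loops have `l + l` and `i + i`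
    -- further interior vertices, again `ι + ι` in all, so `same-bound` covers them.
    chord-bound : ∀ i j → i + j ≡ ι + ι → pinched (λ c d → L * A c d) (suc i) (suc j) ≤ 4 * T₀
    chord-bound = pinched-wlog (λ c d → L * A c d) (4 * T₀) short
      where
      open ≤-Reasoning
      short : ∀ i l → l + i ≡ ι → pinched (λ c d → L * A c d) (suc i) (suc (ι + l)) ≤ 4 * T₀
      short i l l+i = begin
        pinched (λ c d → L * A c d) (suc i) (suc (ι + l))
          ≡⟨ pinched-split (λ c d → L * A c d) i ι l 0 ⟩
        (∬ λ a b → sum λ c → sum λ d → L * A c d * (x a b c * y a b d))
          ≤⟨ ∬-mono local ⟩
        (∬ λ a b → 2 * (h (suc ι) a b * h (suc ι) a b) + c₁ * Y a b + c₂ * X a b)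
          ≡⟨ trans (∬-+ (λ a b → 2 * (h (suc ι) a b * h (suc ι) a b) + c₁ * Y a b) (λ a b → c₂ * X a b)) (cong₂ _+_
               (trans (∬-+ (λ a b → 2 * (h (suc ι) a b * h (suc ι) a b)) (λ a b → c₁ * Y a b)) (cong₂ _+_
                 (∬-* 2 λ a b → h (suc ι) a b * h (suc ι) a b) (∬-* c₁ Y)))
               (∬-* c₂ X)) ⟩
        2 * T₀ + c₁ * U + c₂ * ∬ X
          ≤⟨ +-mono-≤ (+-monoʳ-≤ (2 * T₀) small₂) (subst (λ S → c₂ * S ≤ T₀) (≡-sym (via-squares l i))
               (same-bound c₂ small₃ (l + l) (i + i) double)) ⟩
        2 * T₀ + T₀ + T₀
          ≡⟨ four T₀ ⟩
        4 * T₀ ∎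
        where
        x y : Fin n → Fin n → Fin n → ℕ
        x a b c = via l i a b c
        y a b d = via 0 ι b a d
        X Y : Fin n → Fin n → ℕ
        X a b = sum λ c → x a b c * x a b c
        Y a b = sum λ c → y a b c * y a b c
        four : ∀ t → 2 * t + t + t ≡ 4 * t
        four = solve-∀
        interchange : ∀ l i → l + l + (i + i) ≡ l + i + (l + i)
        interchange = solve-∀
        double : l + l + (i + i) ≡ ι + ι
        double = trans (interchange l i) (cong₂ _+_ l+i l+i)
        total : ∀ a b → sum (x a b) ≡ h (suc ι) a b
        total a b = trans (sum-via l i a b) (cong (λ k → h (suc k) a b) l+i)
        local : ∀ a b → (sum λ c → sum λ d → L * A c d * (x a b c * y a b d)) ≤
          2 * (h (suc ι) a b * h (suc ι) a b) + c₁ * Y a b + c₂ * X a b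
        local a b = begin
          (sum λ c → sum λ d → L * A c d * (x a b c * y a b d))
            ≡⟨ sum-cong-≗ (λ c → trans (sum-cong-≗ λ d → *-assoc L (A c d) (x a b c * y a b d))
                 (≡-sym (*-distribˡ-sum L λ d → A c d * (x a b c * y a b d)))) ⟩
          (sum λ c → L * sum λ d → A c d * (x a b c * y a b d))
            ≡⟨ *-distribˡ-sum L (λ c → sum λ d → A c d * (x a b c * y a b d)) ⟨
          L * (sum λ c → sum λ d → A c d * (x a b c * y a b d))
            ≤⟨ density-bound r free (y a b) (x a b) (trans (sum-via 0 ι b a) (trans (h-sym (suc ι) b a) (≡-sym (total a b)))) L ⟩
          2 * (sum (x a b) * sum (x a b)) + c₁ * Y a b + c₂ * X a b
            ≡⟨ cong (λ N → 2 * (N * N) + c₁ * Y a b + c₂ * X a b) (total a b) ⟩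
          2 * (h (suc ι) a b * h (suc ι) a b) + c₁ * Y a b + c₂ * X a b ∎

    clash-bound : ∀ i j → i + j ≡ ι + ι → L * pinched clash (suc i) (suc j) ≤ 5 * T₀
    clash-bound i j i+j = begin
      L * pinched clash (suc i) (suc j)
        ≡⟨ ∬-* L (λ c d → clash c d * H c d) ⟨
      (∬ λ c d → L * (clash c d * H c d))
        ≡⟨ ∬-cong (λ c d → expand L (same c d) (A c d) (H c d)) ⟩
      (∬ λ c d → L * (same c d * H c d) + L * A c d * H c d)
        ≡⟨ trans (∬-+ (λ c d → L * (same c d * H c d)) (λ c d → L * A c d * H c d))
             (cong (_+ pinched (λ c d → L * A c d) (suc i) (suc j)) (∬-* L λ c d → same c d * H c d)) ⟩
      L * pinched same (suc i) (suc j) + pinched (λ c d → L * A c d) (suc i) (suc j)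
        ≤⟨ +-mono-≤ (same-bound L small₁ i j i+j) (chord-bound i j i+j) ⟩
      5 * T₀ ∎
      where
      open ≤-Reasoning
      H : Fin n → Fin n → ℕ
      H c d = h (suc i) c d * h (suc j) c d
      expand : ∀ L e a x → L * ((e + a) * x) ≡ L * (e * x) + L * a * x
      expand = solve-∀

-- Positions on the cycle

*-positive : ∀ x y → 0 < x * y → 0 < x × 0 < y
*-positive (suc x) (suc y) _ = z<s , z<s
*-positive (suc x) zero p rewrite *-zeroʳ x = contradiction p λ ()

⟦⟧-positive : ∀ {b} → 0 < ⟦ b ⟧ → b ≡ true
⟦⟧-positive {true} _ = refl

<⇒<ᵇ≡true : ∀ {i j} → i < j → (i <ᵇ j) ≡ true
<⇒<ᵇ≡true p = Equivalence.to T-≡ (<⇒<ᵇ p)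

≡ᵇ≡true⇒≡ : ∀ i j → (i ≡ᵇ j) ≡ true → i ≡ j
≡ᵇ≡true⇒≡ i j e = ≡ᵇ⇒≡ i j (Equivalence.from T-≡ e)

≡⇒≡ᵇ≡true : ∀ {i j} → i ≡ j → (i ≡ᵇ j) ≡ true
≡⇒≡ᵇ≡true {i} {j} e = Equivalence.to T-≡ (≡⇒≡ᵇ i j e)

∨-true : ∀ a b → a ∨ b ≡ true → a ≡ true ⊎ b ≡ true
∨-true true b _ = inj₁ refl
∨-true false b e = inj₂ e

∧-true : ∀ a b → a ∧ b ≡ true → a ≡ true × b ≡ true
∧-true true true _ = refl , refl

data Consecutive (m : ℕ) (i j : ℕ) : Set where
  next : suc i ≡ j → Consecutive m i j
  prev : suc j ≡ i → Consecutive m i j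
  wrap : i ≡ 0 → suc j ≡ m → Consecutive m i j
  wrap′ : j ≡ 0 → suc i ≡ m → Consecutive m i j

cycAdj⇒consecutive : ∀ (i j : Fin m) → cycAdj m i j ≡ true → Consecutive m (toℕ i) (toℕ j)
cycAdj⇒consecutive i j e with ∨-true _ _ e
... | inj₁ p = next (≡ᵇ≡true⇒≡ _ _ p)
... | inj₂ e′ with ∨-true _ _ e′
...   | inj₁ p = prev (≡ᵇ≡true⇒≡ _ _ p)
...   | inj₂ e″ with ∨-true _ _ e″
...     | inj₁ p = let q , r = ∧-true _ _ p in wrap (≡ᵇ≡true⇒≡ _ _ q) (≡ᵇ≡true⇒≡ _ _ r)
...     | inj₂ p = let q , r = ∧-true _ _ p in wrap′ (≡ᵇ≡true⇒≡ _ _ q) (≡ᵇ≡true⇒≡ _ _ r)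

consecutive⇒cycAdj : ∀ (i j : Fin m) → Consecutive m (toℕ i) (toℕ j) → cycAdj m i j ≡ true
consecutive⇒cycAdj i j (next p) rewrite ≡⇒≡ᵇ≡true p = refl
consecutive⇒cycAdj i j (prev p) rewrite ≡⇒≡ᵇ≡true p = ∨-zeroʳ _
consecutive⇒cycAdj {m} i j (wrap p q) rewrite ≡⇒≡ᵇ≡true p | ≡⇒≡ᵇ≡true q =
  trans (cong ((suc (toℕ i) ≡ᵇ toℕ j) ∨_) (∨-zeroʳ _)) (∨-zeroʳ _)
consecutive⇒cycAdj {m} i j (wrap′ p q) rewrite ≡⇒≡ᵇ≡true p | ≡⇒≡ᵇ≡true q =
  trans (cong ((suc (toℕ i) ≡ᵇ toℕ j) ∨_) (trans (cong ((suc (toℕ j) ≡ᵇ toℕ i) ∨_) (∨-zeroʳ _)) (∨-zeroʳ _))) (∨-zeroʳ _)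

cycAdj-sym : ∀ (i j : Fin m) → cycAdj m i j ≡ cycAdj m j i
cycAdj-sym {m} i j = swap (suc (toℕ i) ≡ᵇ toℕ j) (suc (toℕ j) ≡ᵇ toℕ i)
  ((toℕ i ≡ᵇ 0) ∧ (suc (toℕ j) ≡ᵇ m)) ((toℕ j ≡ᵇ 0) ∧ (suc (toℕ i) ≡ᵇ m))
  where
  swap : ∀ p q r s → p ∨ q ∨ r ∨ s ≡ q ∨ p ∨ s ∨ r
  swap false false r s = ∨-comm r s
  swap false true r s = refl
  swap true false r s = refl
  swap true true r s = refl

cycAdj-irrefl : 2 ≤ m → ∀ (i : Fin m) → cycAdj m i i ≡ false
cycAdj-irrefl {m} 2≤m i with cycAdj m i i in e
... | false = refl
... | true with cycAdj⇒consecutive i i e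
...   | next p = contradiction p 1+n≢n
...   | prev p = contradiction p 1+n≢n
...   | wrap p q = contradiction (subst (2 ≤_) (trans (≡-sym q) (cong suc p)) 2≤m) λ { (s≤s ()) }
...   | wrap′ p q = contradiction (subst (2 ≤_) (trans (≡-sym q) (cong suc p)) 2≤m) λ { (s≤s ()) }

-- The pairs for which a clash has to be excluded, each in one order only. Consecutive positions of
-- a closed walk hold adjacent, hence distinct, vertices anyway.
far : ∀ {m} → Fin m → Fin m → Bool
far {m} i j = (toℕ i <ᵇ toℕ j) ∧ not (cycAdj m i j)

-- Closed walks as tuples of vertices, and the union bound

module ClosedWalks {n : ℕ} (G : Graph n) (w : Fin n → ℕ) where
  open Pinched G w

  path : Fin n → Vec (Fin n) m → Fin n → ℕ
  path a [] b = A a b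
  path a (c ∷ v) b = A a c * w c * path c v b

  ∑-path : ∀ m a b → ∑ⱽ m (λ v → path a v b) ≡ h m a b
  ∑-path zero a b = refl
  ∑-path (suc m) a b = sum-cong-≗ λ c → trans (∑ⱽ-* m (A a c * w c) λ v → path c v b) (cong (A a c * w c *_) (∑-path m c b))

  ∑-path-one : ∀ m (f : Fin n → ℕ) (j : Fin m) q → toℕ j + suc q ≡ m → ∀ a b →
    ∑ⱽ m (λ v → path a v b * f (lookup v j)) ≡ sum λ c → via (toℕ j) q a b c * f c
  ∑-path-one (suc m) f zero q refl a b = sum-cong-≗ λ c → begin
    ∑ⱽ m (λ v → A a c * w c * path c v b * f c)   ≡⟨ ∑ⱽ-cong m (λ v → arrange (A a c * w c) (path c v b) (f c)) ⟩
    ∑ⱽ m (λ v → A a c * w c * f c * path c v b)   ≡⟨ ∑ⱽ-* m (A a c * w c * f c) (λ v → path c v b) ⟩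
    A a c * w c * f c * ∑ⱽ m (λ v → path c v b)   ≡⟨ cong (A a c * w c * f c *_) (∑-path m c b) ⟩
    A a c * w c * f c * h m c b                   ≡⟨ arrange (A a c * w c) (f c) (h m c b) ⟩
    A a c * w c * h m c b * f c                   ∎
    where
    open ≡-Reasoning
    arrange : ∀ x p f → x * p * f ≡ x * f * p
    arrange = solve-∀
  ∑-path-one (suc m) f (suc j) q e a b = begin
    (sum λ c → ∑ⱽ m λ v → A a c * w c * path c v b * f (lookup v j))
      ≡⟨ sum-cong-≗ (λ c → trans (∑ⱽ-cong m λ v → *-assoc (A a c * w c) (path c v b) (f (lookup v j)))
           (trans (∑ⱽ-* m (A a c * w c) λ v → path c v b * f (lookup v j))
           (cong (A a c * w c *_) (∑-path-one m f j q (suc-injective e) c b)))) ⟩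
    (sum λ c → A a c * w c * sum λ d → h (toℕ j) c d * w d * h q d b * f d)
      ≡⟨ sum-cong-≗ (λ c → *-distribˡ-sum (A a c * w c) λ d → h (toℕ j) c d * w d * h q d b * f d) ⟩
    (sum λ c → sum λ d → A a c * w c * (h (toℕ j) c d * w d * h q d b * f d))
      ≡⟨ ∑-comm (λ c d → A a c * w c * (h (toℕ j) c d * w d * h q d b * f d)) ⟩
    (sum λ d → sum λ c → A a c * w c * (h (toℕ j) c d * w d * h q d b * f d))
      ≡⟨ sum-cong-≗ (λ d → trans (sum-cong-≗ λ c → arrange (A a c * w c) (h (toℕ j) c d) (w d) (h q d b) (f d))
           (trans (≡-sym (*-distribʳ-sum (w d * h q d b * f d) λ c → A a c * w c * h (toℕ j) c d))
           (assoc (h (suc (toℕ j)) a d) (w d) (h q d b) (f d)))) ⟩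
    (sum λ d → via (suc (toℕ j)) q a b d * f d) ∎
    where
    open ≡-Reasoning
    arrange : ∀ x p q r s → x * (p * q * r * s) ≡ x * p * (q * r * s)
    arrange = solve-∀
    assoc : ∀ x p q r → x * (p * q * r) ≡ x * p * q * r
    assoc = solve-∀

  -- Induction strips off the vertices before position `i`; with the vertex there fixed, one marked
  -- position remains. There are `g` interior vertices between the marks and `q` after the second.
  ∑-path-two : ∀ m (R : Fin n → Fin n → ℕ) (i j : Fin m) g q → toℕ j ≡ toℕ i + suc g → toℕ j + suc q ≡ m → ∀ a b →
    ∑ⱽ m (λ v → path a v b * R (lookup v i) (lookup v j)) ≡
    sum λ c → h (toℕ i) a c * w c * sum λ d → via g q c b d * R c d
  ∑-path-two (suc m) R zero (suc j) g q refl e a b = sum-cong-≗ λ c →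
    trans (∑ⱽ-cong m λ v → *-assoc (A a c * w c) (path c v b) (R c (lookup v j)))
    (trans (∑ⱽ-* m (A a c * w c) λ v → path c v b * R c (lookup v j))
    (cong (A a c * w c *_) (∑-path-one m (R c) j q (suc-injective e) c b)))
  ∑-path-two (suc m) R (suc i) (suc j) g q g≡ e a b = begin
    (sum λ c → ∑ⱽ m λ v → A a c * w c * path c v b * R (lookup v i) (lookup v j))
      ≡⟨ sum-cong-≗ (λ c → trans (∑ⱽ-cong m λ v → *-assoc (A a c * w c) (path c v b) (R (lookup v i) (lookup v j)))
           (trans (∑ⱽ-* m (A a c * w c) λ v → path c v b * R (lookup v i) (lookup v j))
           (cong (A a c * w c *_) (∑-path-two m R i j g q (suc-injective g≡) (suc-injective e) c b)))) ⟩
    (sum λ c → A a c * w c * sum λ d → h (toℕ i) c d * w d * S d)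
      ≡⟨ sum-cong-≗ (λ c → *-distribˡ-sum (A a c * w c) λ d → h (toℕ i) c d * w d * S d) ⟩
    (sum λ c → sum λ d → A a c * w c * (h (toℕ i) c d * w d * S d))
      ≡⟨ ∑-comm (λ c d → A a c * w c * (h (toℕ i) c d * w d * S d)) ⟩
    (sum λ d → sum λ c → A a c * w c * (h (toℕ i) c d * w d * S d))
      ≡⟨ sum-cong-≗ (λ d → trans (sum-cong-≗ λ c → arrange (A a c * w c) (h (toℕ i) c d) (w d) (S d))
           (trans (≡-sym (*-distribʳ-sum (w d * S d) λ c → A a c * w c * h (toℕ i) c d))
           (≡-sym (*-assoc (h (suc (toℕ i)) a d) (w d) (S d))))) ⟩
    (sum λ d → h (suc (toℕ i)) a d * w d * S d) ∎
    where
    open ≡-Reasoning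
    S : Fin n → ℕ
    S c = sum λ d → via g q c b d * R c d
    arrange : ∀ x p q r → x * (p * q * r) ≡ x * p * (q * r)
    arrange = solve-∀

  closedWalk : Vec (Fin n) (suc m) → ℕ
  closedWalk (a ∷ v) = w a * path a v a

  ∑-closedWalk : ∀ m → ∑ⱽ (suc m) closedWalk ≡ closed m
  ∑-closedWalk m = sum-cong-≗ λ a → trans (∑ⱽ-* m (w a) λ v → path a v a) (cong (w a *_) (∑-path m a a))

  ∑-closedWalk-first : ∀ m R (j : Fin m) q → toℕ j + suc q ≡ m →
    ∑ⱽ (suc m) (λ x → closedWalk x * R (lookup x zero) (lookup x (suc j))) ≡ pinched R (toℕ j) q
  ∑-closedWalk-first m R j q e = sum-cong-≗ λ a → begin
    ∑ⱽ m (λ v → w a * path a v a * R a (lookup v j))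
      ≡⟨ ∑ⱽ-cong m (λ v → *-assoc (w a) (path a v a) (R a (lookup v j))) ⟩
    ∑ⱽ m (λ v → w a * (path a v a * R a (lookup v j)))
      ≡⟨ ∑ⱽ-* m (w a) (λ v → path a v a * R a (lookup v j)) ⟩
    w a * ∑ⱽ m (λ v → path a v a * R a (lookup v j))
      ≡⟨ cong (w a *_) (∑-path-one m (R a) j q e a a) ⟩
    w a * (sum λ d → via (toℕ j) q a a d * R a d)
      ≡⟨ *-distribˡ-sum (w a) (λ d → via (toℕ j) q a a d * R a d) ⟩
    (sum λ d → w a * (via (toℕ j) q a a d * R a d))
      ≡⟨ sum-cong-≗ (λ d → trans (cong (λ x → w a * (h (toℕ j) a d * w d * x * R a d)) (h-sym q d a))
           (arrange (w a) (h (toℕ j) a d) (w d) (h q a d) (R a d))) ⟩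
    (sum λ d → w a * w d * (R a d * (h (toℕ j) a d * h q a d))) ∎
    where
    open ≡-Reasoning
    arrange : ∀ wa x wd y r → wa * (x * wd * y * r) ≡ wa * wd * (r * (x * y))
    arrange = solve-∀

  -- The root, at position zero, is unmarked and gets summed out: it joins the `q` vertices after
  -- the second mark to the `toℕ i` vertices before the first, whence the arc `suc (q + toℕ i)`.
  ∑-closedWalk-later : ∀ m R (i j : Fin m) g q → toℕ j ≡ toℕ i + suc g → toℕ j + suc q ≡ m →
    ∑ⱽ (suc m) (λ x → closedWalk x * R (lookup x (suc i)) (lookup x (suc j))) ≡ pinched R g (suc (q + toℕ i))
  ∑-closedWalk-later m R i j g q g≡ e = begin
    (sum λ a → ∑ⱽ m λ v → w a * path a v a * R (lookup v i) (lookup v j))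
      ≡⟨ sum-cong-≗ (λ a → trans (∑ⱽ-cong m λ v → *-assoc (w a) (path a v a) (R (lookup v i) (lookup v j)))
           (trans (∑ⱽ-* m (w a) λ v → path a v a * R (lookup v i) (lookup v j))
           (trans (cong (w a *_) (∑-path-two m R i j g q g≡ e a a))
           (trans (*-distribˡ-sum (w a) λ c → h (toℕ i) a c * w c * sum λ d → via g q c a d * R c d)
           (sum-cong-≗ λ c → trans (≡-sym (*-assoc (w a) (h (toℕ i) a c * w c) _)) (*-distribˡ-sum (w a * (h (toℕ i) a c * w c)) λ d → via g q c a d * R c d)))))) ⟩
    (sum λ a → sum λ c → sum λ d → w a * (h (toℕ i) a c * w c) * (via g q c a d * R c d))
      ≡⟨ ∑-comm (λ a c → sum λ d → w a * (h (toℕ i) a c * w c) * (via g q c a d * R c d)) ⟩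
    (sum λ c → sum λ a → sum λ d → w a * (h (toℕ i) a c * w c) * (via g q c a d * R c d))
      ≡⟨ sum-cong-≗ (λ c → ∑-comm λ a d → w a * (h (toℕ i) a c * w c) * (via g q c a d * R c d)) ⟩
    (sum λ c → sum λ d → sum λ a → w a * (h (toℕ i) a c * w c) * (via g q c a d * R c d))
      ≡⟨ sum-cong-≗ (λ c → sum-cong-≗ λ d → close c d) ⟩
    pinched R g (suc (q + toℕ i)) ∎
    where
    open ≡-Reasoning
    arrange : ∀ wa x wc y wd z r → wa * (x * wc) * (y * wd * z * r) ≡ wc * wd * (r * y) * (z * wa * x)
    arrange = solve-∀
    close : ∀ c d → (sum λ a → w a * (h (toℕ i) a c * w c) * (via g q c a d * R c d)) ≡
      w c * w d * (R c d * (h g c d * h (suc (q + toℕ i)) c d))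
    close c d = begin
      (sum λ a → w a * (h (toℕ i) a c * w c) * (via g q c a d * R c d))
        ≡⟨ sum-cong-≗ (λ a → arrange (w a) (h (toℕ i) a c) (w c) (h g c d) (w d) (h q d a) (R c d)) ⟩
      (sum λ a → w c * w d * (R c d * h g c d) * via q (toℕ i) d c a)
        ≡⟨ *-distribˡ-sum (w c * w d * (R c d * h g c d)) (via q (toℕ i) d c) ⟨
      w c * w d * (R c d * h g c d) * sum (via q (toℕ i) d c)
        ≡⟨ cong (w c * w d * (R c d * h g c d) *_) (trans (sum-via q (toℕ i) d c) (h-sym (suc (q + toℕ i)) d c)) ⟩
      w c * w d * (R c d * h g c d) * h (suc (q + toℕ i)) c d
        ≡⟨ assoc (w c * w d) (R c d) (h g c d) (h (suc (q + toℕ i)) c d) ⟩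
      w c * w d * (R c d * (h g c d * h (suc (q + toℕ i)) c d)) ∎
      where
      assoc : ∀ x r y z → x * (r * y) * z ≡ x * (r * (y * z))
      assoc = solve-∀

  path-step : ∀ a (v : Vec (Fin n) m) b → 0 < path a v b → ∀ i j → suc (toℕ i) ≡ toℕ j →
    adj G (lookup (a ∷ v) i) (lookup (a ∷ v) j) ≡ true
  path-step a (c ∷ v) b p zero (suc zero) _ = ⟦⟧-positive (proj₁ (*-positive (A a c) (w c) (proj₁ (*-positive (A a c * w c) _ p))))
  path-step a (c ∷ v) b p (suc i) (suc j) e = path-step c v b (proj₂ (*-positive (A a c * w c) _ p)) i j (suc-injective e)
  path-step a [] b p zero zero ()

  path-last : ∀ a (v : Vec (Fin n) m) b → 0 < path a v b → ∀ i → suc (toℕ i) ≡ suc m → adj G (lookup (a ∷ v) i) b ≡ true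
  path-last a [] b p zero _ = ⟦⟧-positive p
  path-last a (c ∷ v) b p (suc i) e = path-last c v b (proj₂ (*-positive (A a c * w c) _ p)) i (suc-injective e)

  closedWalk-adj : (x : Vec (Fin n) (suc m)) → 0 < closedWalk x → ∀ i j → Consecutive (suc m) (toℕ i) (toℕ j) →
    adj G (lookup x i) (lookup x j) ≡ true
  closedWalk-adj (a ∷ v) p i j (next e) = path-step a v a (proj₂ (*-positive (w a) _ p)) i j e
  closedWalk-adj (a ∷ v) p i j (prev e) = trans (sym G _ _) (path-step a v a (proj₂ (*-positive (w a) _ p)) j i e)
  closedWalk-adj (a ∷ v) p zero j (wrap _ e) = trans (sym G _ _) (path-last a v a (proj₂ (*-positive (w a) _ p)) j e)
  closedWalk-adj (a ∷ v) p i zero (wrap′ _ e) = path-last a v a (proj₂ (*-positive (w a) _ p)) i e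

  -- Positive weight supplies the edges of the cycle, and with them distinctness of consecutive
  -- vertices. The absence of clashes settles all other pairs.
  induced : (x : Vec (Fin n) (suc (suc m))) → 0 < closedWalk x →
    (∀ i j → far i j ≡ true → clash (lookup x i) (lookup x j) ≡ 0) → ContainsInducedCycle (suc (suc m)) G
  induced {m} x p clear = lookup x , (λ {i} {j} → injective i j) , faithful
    where
    cyc = cycAdj (suc (suc m))
    ordered : ∀ i j → toℕ i < toℕ j →
      lookup x i ≢ lookup x j × adj G (lookup x i) (lookup x j) ≡ cyc i j
    ordered i j i<j with cyc i j in e
    ... | true = (λ x≡ → case-≢ (trans (≡-sym x-adj) (trans (cong (λ y → adj G y (lookup x j)) x≡) (irrefl G _)))) , x-adj
      where
      x-adj = closedWalk-adj x p i j (cycAdj⇒consecutive i j e)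
      case-≢ : true ≢ false
      case-≢ ()
    ... | false = distinct , ⟦⟧≡0⇒false _ (m+n≡0⇒n≡0 (same (lookup x i) (lookup x j)) zeros)
      where
      zeros : clash (lookup x i) (lookup x j) ≡ 0
      zeros = clear i j (cong₂ (λ a b → a ∧ not b) (<⇒<ᵇ≡true i<j) e)
      distinct : lookup x i ≢ lookup x j
      distinct x≡ with trans (≡-sym (cong ⟦_⟧ (==-refl (lookup x i)))) (trans (cong (same (lookup x i)) x≡) (m+n≡0⇒m≡0 _ zeros))
      ... | ()
    injective : ∀ i j → lookup x i ≡ lookup x j → i ≡ j
    injective i j e with <-cmp (toℕ i) (toℕ j)
    ... | tri< i<j _ _ = contradiction e (proj₁ (ordered i j i<j))
    ... | tri≈ _ i≡j _ = toℕ-injective i≡j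
    ... | tri> _ _ j<i = contradiction (≡-sym e) (proj₁ (ordered j i j<i))
    faithful : ∀ i j → adj G (lookup x i) (lookup x j) ≡ cyc i j
    faithful i j with <-cmp (toℕ i) (toℕ j)
    ... | tri< i<j _ _ = proj₂ (ordered i j i<j)
    ... | tri> _ _ j<i = trans (sym G _ _) (trans (proj₂ (ordered j i j<i)) (cycAdj-sym j i))
    ... | tri≈ _ i≡j _ rewrite toℕ-injective i≡j = trans (irrefl G _) (≡-sym (cycAdj-irrefl (s≤s (s≤s z≤n)) j))

  clashes : Vec (Fin n) m → ℕ
  clashes x = sum λ i → sum λ j → ⟦ far i j ⟧ * clash (lookup x i) (lookup x j)

  -- The pointwise form of the union bound: a closed walk of positive weight without a far clash
  -- would be an induced cycle.
  closedWalk-clashes : ¬ ContainsInducedCycle (suc (suc m)) G → (x : Vec (Fin n) (suc (suc m))) →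
    closedWalk x ≤ closedWalk x * clashes x
  closedWalk-clashes {m} free x with closedWalk x in e
  ... | zero = z≤n
  ... | suc k with clashes x in e′
  ...   | suc l = m≤m*n (suc k) (suc l)
  ...   | zero = contradiction (induced x (subst (0 <_) (≡-sym e) z<s) clear) free
    where
    clear : ∀ i j → far i j ≡ true → clash (lookup x i) (lookup x j) ≡ 0
    clear i j f = n≤0⇒n≡0 (begin
      clash (lookup x i) (lookup x j)                   ≡⟨ +-identityʳ _ ⟨
      1 * clash (lookup x i) (lookup x j)               ≡⟨ cong (λ b → ⟦ b ⟧ * clash (lookup x i) (lookup x j)) f ⟨
      ⟦ far i j ⟧ * clash (lookup x i) (lookup x j)     ≤⟨ term≤sum (λ j → ⟦ far i j ⟧ * clash (lookup x i) (lookup x j)) j ⟩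
      (sum λ j → ⟦ far i j ⟧ * clash (lookup x i) (lookup x j)) ≤⟨ term≤sum (λ i → sum λ j → ⟦ far i j ⟧ * clash (lookup x i) (lookup x j)) i ⟩
      clashes x                                         ≡⟨ e′ ⟩
      0 ∎)
      where open ≤-Reasoning

  -- A far pair of positions cuts the closed walk into two arcs, each with an interior vertex.
  far-pair : ∀ m R (i j : Fin (suc m)) → far i j ≡ true → ∃[ g ] ∃[ q ] suc (suc (suc (g + q))) ≡ m ×
    ∑ⱽ (suc m) (λ x → closedWalk x * R (lookup x i) (lookup x j)) ≡ pinched R (suc g) (suc q)
  far-pair m R i j f = split i j (<ᵇ⇒< (toℕ i) (toℕ j) (Equivalence.from T-≡ (proj₁ both))) not-consecutive
    where
    both = ∧-true _ _ f
    not-consecutive : ¬ Consecutive (suc m) (toℕ i) (toℕ j)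
    not-consecutive c with trans (≡-sym (cong not (consecutive⇒cycAdj i j c))) (proj₂ both)
    ... | ()
    split : ∀ i j → toℕ i < toℕ j → ¬ Consecutive (suc m) (toℕ i) (toℕ j) → ∃[ g ] ∃[ q ] suc (suc (suc (g + q))) ≡ m ×
      ∑ⱽ (suc m) (λ x → closedWalk x * R (lookup x i) (lookup x j)) ≡ pinched R (suc g) (suc q)
    split zero (suc j) i<j apart with toℕ j in j≡ | m≤n⇒∃[o]m+o≡n (toℕ<n j)
    ... | zero | _ = contradiction (next refl) apart
    ... | suc g | zero , e = contradiction (wrap refl (cong suc (trans (≡-sym (+-identityʳ (suc (suc g)))) e))) apart
    ... | suc g | suc q , e = g , q , trans (cong suc (cong suc (≡-sym (+-suc g q)))) e ,
      trans (∑-closedWalk-first m R j (suc q) (trans (+-suc (toℕ j) (suc q)) (trans (cong (λ x → suc x + suc q) j≡) e)))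
            (cong (λ x → pinched R x (suc q)) j≡)
    split (suc i) (suc j) i<j apart with m≤n⇒∃[o]m+o≡n i<j | m≤n⇒∃[o]m+o≡n (toℕ<n j)
    ... | zero , e | _ = contradiction (next (trans (≡-sym (+-identityʳ _)) e)) apart
    ... | suc g , e | q , e′ = g , q + toℕ i ,
      trans (cong (3 +_) (rotate g q (toℕ i))) (trans (cong (λ x → suc x + q) (≡-sym j≡)) e′) ,
      ∑-closedWalk-later m R i j (suc g) q (trans j≡ shape) (trans (+-suc (toℕ j) q) e′)
      where
      j≡ : toℕ j ≡ suc (suc (toℕ i + g))
      j≡ = suc-injective (trans (≡-sym e) (cong (2 +_) (+-suc (toℕ i) g)))
      shape : suc (suc (toℕ i + g)) ≡ toℕ i + suc (suc g)
      shape = trans (cong suc (≡-sym (+-suc (toℕ i) g))) (≡-sym (+-suc (toℕ i) (suc g)))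
      rotate : ∀ g q i → g + (q + i) ≡ i + g + q
      rotate = solve-∀

  -- Summing `closedWalk-clashes` over all tuples leaves one pinched sum for each far pair of
  -- positions; the remaining pairs contribute nothing.
  closed-bound : ∀ m → ¬ ContainsInducedCycle (suc (suc m)) G → ∀ L B →
    (∀ g q → suc (suc (g + q)) ≡ m → L * pinched clash (suc g) (suc q) ≤ B) →
    L * closed (suc m) ≤ suc (suc m) * (suc (suc m) * B)
  closed-bound m free L B bound = begin
    L * closed (suc m)
      ≡⟨ cong (L *_) (∑-closedWalk (suc m)) ⟨
    L * ∑ⱽ M closedWalk
      ≤⟨ *-monoʳ-≤ L (∑ⱽ-mono M (closedWalk-clashes free)) ⟩
    L * ∑ⱽ M (λ x → closedWalk x * clashes x)
      ≡⟨ cong (L *_) (trans (∑ⱽ-cong M λ x → trans (*-distribˡ-sum (closedWalk x) λ i → sum λ j → ⟦ far i j ⟧ * clash (lookup x i) (lookup x j))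
           (sum-cong-≗ λ i → *-distribˡ-sum (closedWalk x) λ j → ⟦ far i j ⟧ * clash (lookup x i) (lookup x j)))
           (trans (∑ⱽ-sum M λ x i → sum λ j → closedWalk x * (⟦ far i j ⟧ * clash (lookup x i) (lookup x j)))
           (sum-cong-≗ λ i → ∑ⱽ-sum M λ x j → closedWalk x * (⟦ far i j ⟧ * clash (lookup x i) (lookup x j))))) ⟩
    L * (sum λ i → sum λ j → F i j)
      ≡⟨ trans (*-distribˡ-sum L λ i → sum (F i)) (sum-cong-≗ λ i → *-distribˡ-sum L (F i)) ⟩
    (sum λ i → sum λ j → L * F i j)
      ≤⟨ sum-mono (λ i → sum-mono λ j → each i j) ⟩
    (sum {M} λ i → sum {M} λ j → B)
      ≡⟨ trans (sum-cong-≗ {M} λ i → sum-const M B) (sum-const M (M * B)) ⟩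
    M * (M * B) ∎
    where
    open ≤-Reasoning
    M = suc (suc m)
    F : Fin M → Fin M → ℕ
    F i j = ∑ⱽ M λ x → closedWalk x * (⟦ far i j ⟧ * clash (lookup x i) (lookup x j))
    each : ∀ i j → L * F i j ≤ B
    each i j with far i j in e
    ... | false = subst (_≤ B) (≡-sym (trans (cong (L *_) (trans (∑ⱽ-cong M λ x → *-zeroʳ (closedWalk x))
                   (∑ⱽ-* M 0 λ (x : Vec (Fin n) M) → 0))) (*-zeroʳ L))) z≤n
    ... | true = let g , q , e′ , split = far-pair (suc m) clash i j e in
      subst (_≤ B) (cong (L *_) (trans (≡-sym split) (∑ⱽ-cong M λ x → cong (closedWalk x *_) (≡-sym (+-identityʳ (clash (lookup x i) (lookup x j)))))))
        (bound g q (suc-injective e′))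

-- The simple random walk on a set of large minimum degree

degree : Graph n → (Fin n → Bool) → Fin n → ℕ
degree G σ a = sum λ b → ⟦ adj G a b ⟧ * ⟦ σ b ⟧

-- `balanced` expresses w = D / degree on `σ`. `light` is the minimum degree condition, w ≤ D / δ,
-- and for positive `δ` it also makes the weight vanish outside `σ`.
module Balanced {n : ℕ} (G : Graph n) (w : Fin n → ℕ) (σ : Fin n → Bool) (D δ : ℕ)
  (balanced : ∀ a → w a * degree G σ a ≡ D * ⟦ σ a ⟧)
  (light : ∀ a → δ * w a ≤ D * ⟦ σ a ⟧) where
  open Pinched G w

  private
    d : Fin n → ℕ
    d = degree G σ
    V = sum λ a → ⟦ σ a ⟧ * d a

  -- The neighbours of `c` weigh at most D / δ each, together D degree(c) / δ, and the factor `w c`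
  -- removes the degree.
  local-weight : ∀ c → δ * (w c * sum λ b → A b c * w b) ≤ D * D
  local-weight c = begin
    δ * (w c * sum λ b → A b c * w b)
      ≡⟨ trans (swap δ (w c) (sum λ b → A b c * w b)) (cong (w c *_) (*-distribˡ-sum δ λ b → A b c * w b)) ⟩
    w c * (sum λ b → δ * (A b c * w b))
      ≤⟨ *-monoʳ-≤ (w c) (sum-mono λ b → ≤-trans (≤-reflexive (swap δ (A b c) (w b))) (*-monoʳ-≤ (A b c) (light b))) ⟩
    w c * (sum λ b → A b c * (D * ⟦ σ b ⟧))
      ≡⟨ cong (w c *_) (trans (sum-cong-≗ λ b → trans (swap (A b c) D ⟦ σ b ⟧) (cong (λ x → D * (x * ⟦ σ b ⟧)) (A-sym b c)))
           (≡-sym (*-distribˡ-sum D λ b → A c b * ⟦ σ b ⟧))) ⟩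
    w c * (D * d c)
      ≡⟨ trans (swap (w c) D (d c)) (cong (D *_) (balanced c)) ⟩
    D * (D * ⟦ σ c ⟧)
      ≤⟨ *-monoʳ-≤ D (≤-trans (*-monoʳ-≤ D (⟦⟧≤1 (σ c))) (≤-reflexive (*-identityʳ D))) ⟩
    D * D ∎
    where
    open ≤-Reasoning
    swap : ∀ p q r → p * (q * r) ≡ q * (p * r)
    swap = solve-∀

  -- Each of the `n` vertices contributes its local weight; in terms of P this is tr P^2 ≤ n / δ.
  moment-zero : δ * moment 0 ≤ n * (D * D)
  moment-zero = begin
    δ * moment 0
      ≡⟨ *-distribˡ-sum δ (λ a → sum λ b → w a * w b * (A a b * A a b)) ⟩
    (sum λ a → δ * sum λ b → w a * w b * (A a b * A a b))
      ≡⟨ sum-cong-≗ (λ a → cong (δ *_) (trans (sum-cong-≗ λ b → simplify a b) (≡-sym (*-distribˡ-sum (w a) λ b → A b a * w b)))) ⟩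
    (sum λ a → δ * (w a * sum λ b → A b a * w b))
      ≤⟨ sum-mono local-weight ⟩
    (sum {n} λ a → D * D)
      ≡⟨ sum-const n (D * D) ⟩
    n * (D * D) ∎
    where
    open ≤-Reasoning
    arrange : ∀ p q r → p * q * r ≡ p * (r * q)
    arrange = solve-∀
    simplify : ∀ a b → w a * w b * (A a b * A a b) ≡ w a * (A b a * w b)
    simplify a b = trans (cong (w a * w b *_) (trans (⟦⟧-idem (adj G a b)) (A-sym a b))) (arrange (w a) (w b) (A b a))

  -- With w = D / degree the weighted walks are those of the simple random walk on σ.
  mass : ∀ ℓ a → w a * (sum λ b → h ℓ a b * ⟦ σ b ⟧) ≡ D ^ suc ℓ * ⟦ σ a ⟧
  mass zero a = trans (balanced a) (cong (_* ⟦ σ a ⟧) (≡-sym (*-identityʳ D)))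
  mass (suc ℓ) a = begin
    w a * (sum λ b → (sum λ c → A a c * w c * h ℓ c b) * ⟦ σ b ⟧)
      ≡⟨ cong (w a *_) (trans (sum-cong-≗ λ b → *-distribʳ-sum ⟦ σ b ⟧ λ c → A a c * w c * h ℓ c b)
           (∑-comm λ b c → A a c * w c * h ℓ c b * ⟦ σ b ⟧)) ⟩
    w a * (sum λ c → sum λ b → A a c * w c * h ℓ c b * ⟦ σ b ⟧)
      ≡⟨ cong (w a *_) (sum-cong-≗ λ c → trans (sum-cong-≗ λ b → *-assoc (A a c * w c) (h ℓ c b) ⟦ σ b ⟧)
           (trans (≡-sym (*-distribˡ-sum (A a c * w c) λ b → h ℓ c b * ⟦ σ b ⟧))
           (trans (*-assoc (A a c) (w c) _) (cong (A a c *_) (mass ℓ c))))) ⟩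
    w a * (sum λ c → A a c * (D ^ suc ℓ * ⟦ σ c ⟧))
      ≡⟨ cong (w a *_) (trans (sum-cong-≗ λ c → swap (A a c) (D ^ suc ℓ) ⟦ σ c ⟧) (≡-sym (*-distribˡ-sum (D ^ suc ℓ) λ c → A a c * ⟦ σ c ⟧))) ⟩
    w a * (D ^ suc ℓ * d a)
      ≡⟨ trans (swap (w a) (D ^ suc ℓ) (d a)) (cong (D ^ suc ℓ *_) (balanced a)) ⟩
    D ^ suc ℓ * (D * ⟦ σ a ⟧)
      ≡⟨ assoc (D ^ suc ℓ) D ⟦ σ a ⟧ ⟩
    D ^ suc (suc ℓ) * ⟦ σ a ⟧ ∎
    where
    open ≡-Reasoning
    swap : ∀ p q r → p * (q * r) ≡ q * (p * r)
    swap = solve-∀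
    assoc : ∀ p q r → p * (q * r) ≡ q * p * r
    assoc = solve-∀

  module _ .{{_ : NonZero V}} where

    -- Cauchy–Schwarz against the eigenvector √(d a) of the top eigenvalue 1, in the form of AM-GM.
    moment-lower : ∀ ℓ → D ^ suc ℓ * D ^ suc ℓ ≤ moment ℓ
    moment-lower ℓ = *-cancelʳ-≤ _ _ (V * V) {{m*n≢0 V V}} (+-cancelʳ-≤ (Q * (V * V)) _ _ (begin
      Q * (V * V) + Q * (V * V)
        ≡⟨ lhs D P V ⟩
      2 * (P * V * (D * (D * P * V)))
        ≡⟨ cong (2 *_) (≡-sym mixed) ⟩
      2 * (∬ λ a b → x a b * y a b)
        ≡⟨ ∬-* 2 (λ a b → x a b * y a b) ⟨
      (∬ λ a b → 2 * (x a b * y a b))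
        ≤⟨ ∬-mono (λ a b → am-gm (x a b) (y a b)) ⟩
      (∬ λ a b → x a b * x a b + y a b * y a b)
        ≡⟨ ∬-+ (λ a b → x a b * x a b) (λ a b → y a b * y a b) ⟩
      (∬ λ a b → x a b * x a b) + (∬ λ a b → y a b * y a b)
        ≡⟨ cong₂ _+_ (trans (∬-cong λ a b → square (h ℓ a b) V) (trans (∬-* (V * V) λ a b → h ℓ a b * h ℓ a b) (*-comm (V * V) (moment ℓ)))) pure ⟩
      moment ℓ * (V * V) + Q * (V * V) ∎))
      where
      open ≤-Reasoning
      P = D ^ ℓ
      Q = D * P * (D * P)
      x y : Fin n → Fin n → ℕ
      x a b = h ℓ a b * V
      -- `V` times the rank-one part of `h ℓ` that belongs to the top eigenvalue.
      y a b = P * (d a * d b)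
      lhs : ∀ D P V → D * P * (D * P) * (V * V) + D * P * (D * P) * (V * V) ≡ 2 * (P * V * (D * (D * P * V)))
      lhs = solve-∀
      square : ∀ h V → h * V * (h * V) ≡ V * V * (h * h)
      square = solve-∀
      arrange : ∀ wa wb h V P da db → wa * wb * (h * V * (P * (da * db))) ≡ P * V * (da * (wa * (h * (wb * db))))
      arrange = solve-∀
      swap : ∀ p q r → p * (q * r) ≡ q * (p * r)
      swap = solve-∀
      reorder : ∀ da D Q s → da * (D * (Q * s)) ≡ D * Q * (s * da)
      reorder = solve-∀
      assoc : ∀ D P V → D * (D * P) * V ≡ D * (D * P * V)
      assoc = solve-∀
      mixed : (∬ λ a b → x a b * y a b) ≡ P * V * (D * (D * P * V))
      mixed = begin-equality
        (∬ λ a b → x a b * y a b)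
          ≡⟨ sum-cong-≗ (λ a → trans (sum-cong-≗ λ b → arrange (w a) (w b) (h ℓ a b) V P (d a) (d b))
               (≡-sym (*-distribˡ-sum (P * V) λ b → d a * (w a * (h ℓ a b * (w b * d b)))))) ⟩
        (sum λ a → P * V * sum λ b → d a * (w a * (h ℓ a b * (w b * d b))))
          ≡⟨ *-distribˡ-sum (P * V) (λ a → sum λ b → d a * (w a * (h ℓ a b * (w b * d b)))) ⟨
        P * V * (sum λ a → sum λ b → d a * (w a * (h ℓ a b * (w b * d b))))
          ≡⟨ cong (P * V *_) (sum-cong-≗ inner) ⟩
        P * V * (sum λ a → D * (D * P) * (⟦ σ a ⟧ * d a))
          ≡⟨ cong (P * V *_) (trans (≡-sym (*-distribˡ-sum (D * (D * P)) λ a → ⟦ σ a ⟧ * d a)) (assoc D P V)) ⟩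
        P * V * (D * (D * P * V)) ∎
        where
        inner : ∀ a → (sum λ b → d a * (w a * (h ℓ a b * (w b * d b)))) ≡ D * (D * P) * (⟦ σ a ⟧ * d a)
        inner a = begin-equality
          (sum λ b → d a * (w a * (h ℓ a b * (w b * d b))))
            ≡⟨ trans (≡-sym (*-distribˡ-sum (d a) λ b → w a * (h ℓ a b * (w b * d b)))) (cong (d a *_) (≡-sym (*-distribˡ-sum (w a) λ b → h ℓ a b * (w b * d b)))) ⟩
          d a * (w a * sum λ b → h ℓ a b * (w b * d b))
            ≡⟨ cong (λ s → d a * (w a * s)) (trans (sum-cong-≗ λ b → trans (cong (h ℓ a b *_) (balanced b)) (swap (h ℓ a b) D ⟦ σ b ⟧))
                 (≡-sym (*-distribˡ-sum D λ b → h ℓ a b * ⟦ σ b ⟧))) ⟩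
          d a * (w a * (D * sum λ b → h ℓ a b * ⟦ σ b ⟧))
            ≡⟨ cong (d a *_) (trans (swap (w a) D (sum λ b → h ℓ a b * ⟦ σ b ⟧)) (cong (D *_) (mass ℓ a))) ⟩
          d a * (D * (D * P * ⟦ σ a ⟧))
            ≡⟨ reorder (d a) D (D * P) ⟦ σ a ⟧ ⟩
          D * (D * P) * (⟦ σ a ⟧ * d a) ∎
      separate : ∀ wa wb P da db → wa * wb * (P * (da * db) * (P * (da * db))) ≡ P * P * ((wa * da * da) * (wb * db * db))
      separate = solve-∀
      rhs : ∀ D P V → P * P * (D * V * (D * V)) ≡ D * P * (D * P) * (V * V)
      rhs = solve-∀
      weighted-degrees : (sum λ a → w a * d a * d a) ≡ D * V
      weighted-degrees = trans (sum-cong-≗ λ a → trans (cong (_* d a) (balanced a)) (*-assoc D ⟦ σ a ⟧ (d a)))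
        (≡-sym (*-distribˡ-sum D λ a → ⟦ σ a ⟧ * d a))
      pure : (∬ λ a b → y a b * y a b) ≡ Q * (V * V)
      pure = begin-equality
        (∬ λ a b → y a b * y a b)
          ≡⟨ sum-cong-≗ (λ a → trans (sum-cong-≗ λ b → separate (w a) (w b) P (d a) (d b))
               (≡-sym (*-distribˡ-sum (P * P) λ b → w a * d a * d a * (w b * d b * d b)))) ⟩
        (sum λ a → P * P * sum λ b → w a * d a * d a * (w b * d b * d b))
          ≡⟨ *-distribˡ-sum (P * P) (λ a → sum λ b → w a * d a * d a * (w b * d b * d b)) ⟨
        P * P * (sum λ a → sum λ b → w a * d a * d a * (w b * d b * d b))
          ≡⟨ cong (P * P *_) (sum-*-sum (λ a → w a * d a * d a) (λ b → w b * d b * d b)) ⟨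
        P * P * ((sum λ a → w a * d a * d a) * (sum λ b → w b * d b * d b))
          ≡⟨ trans (cong (λ s → P * P * (s * s)) weighted-degrees) (rhs D P V) ⟩
        Q * (V * V) ∎

    -- If the last ratio of moments exceeds K D² / δ, then `first-step-bound` suffices. If not, no
    -- ratio exceeds it, and climbing up from `moment-zero` contradicts `moment-lower`.
    first-step-small : ∀ K .{{_ : NonZero K}} .{{_ : NonZero D}} .{{_ : NonZero δ}} ι →
      K ^ (2 + ι) * n < δ ^ (2 + ι) → K * first-step ι ≤ moment (suc ι)
    first-step-small K ι large with δ * moment (suc ι) ≤? K * (D * D) * moment ι
    ... | no large-ratio = *-cancelˡ-≤ δ (begin
      δ * (K * first-step ι)       ≡⟨ swap δ K (first-step ι) ⟩
      K * (δ * first-step ι)       ≤⟨ *-monoʳ-≤ K (first-step-bound δ (D * D) local-weight ι) ⟩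
      K * (D * D * moment ι)       ≡⟨ *-assoc K (D * D) (moment ι) ⟨
      K * (D * D) * moment ι       <⟨ ≰⇒> large-ratio ⟩
      δ * moment (suc ι)           ∎)
      where
      open ≤-Reasoning
      swap : ∀ p q r → p * (q * r) ≡ q * (p * r)
      swap = solve-∀
    ... | yes small-ratio = contradiction large (≤⇒≯ (begin
      δ ^ (2 + ι)        ≤⟨ *-cancelʳ-≤ _ _ E scaled ⟩
      -- There are only `suc ι` ratios; one more factor `K` is given away to match the exponent of
      -- `δ`.
      K ^ suc ι * n      ≤⟨ *-monoˡ-≤ n (^-monoʳ-≤ K (n≤1+n (suc ι))) ⟩
      K ^ (2 + ι) * n    ∎))
      where
      open ≤-Reasoning
      instance
        D*D≢0 : NonZero (D * D)
        D*D≢0 = m*n≢0 D D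
        KDD≢0 : NonZero (K * (D * D))
        KDD≢0 = m*n≢0 K (D * D)
        P≢0 : NonZero (D ^ suc (suc ι))
        P≢0 = m^n≢0 D (suc (suc ι))
      E = D ^ (2 + ι) * D ^ (2 + ι)
      instance
        E≢0 : NonZero E
        E≢0 = m*n≢0 (D ^ (2 + ι)) (D ^ (2 + ι))
      swap : ∀ p q r → p * q * r ≡ q * (p * r)
      swap = solve-∀
      swap′ : ∀ p q r → p * (q * r) ≡ q * (p * r)
      swap′ = solve-∀
      collect : ∀ K D n P → K * (P * P) * (n * (D * D)) ≡ K * n * (D * P * (D * P))
      collect = solve-∀
      scaled : δ ^ (2 + ι) * E ≤ K ^ suc ι * n * E
      scaled = begin
        δ * δ ^ suc ι * E
          ≤⟨ *-monoʳ-≤ (δ * δ ^ suc ι) (moment-lower (suc ι)) ⟩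
        δ * δ ^ suc ι * moment (suc ι)
          ≡⟨ *-assoc δ (δ ^ suc ι) (moment (suc ι)) ⟩
        δ * (δ ^ suc ι * moment (suc ι))
          ≤⟨ *-monoʳ-≤ δ (moment-ratio δ (K * (D * D)) ι small-ratio) ⟩
        δ * ((K * (D * D)) ^ suc ι * moment 0)
          ≡⟨ swap′ δ ((K * (D * D)) ^ suc ι) (moment 0) ⟩
        (K * (D * D)) ^ suc ι * (δ * moment 0)
          ≤⟨ *-monoʳ-≤ ((K * (D * D)) ^ suc ι) moment-zero ⟩
        (K * (D * D)) ^ suc ι * (n * (D * D))
          ≡⟨ cong (_* (n * (D * D))) (trans (^-distribʳ-* (suc ι) K (D * D)) (cong (K ^ suc ι *_) (^-distribʳ-* (suc ι) D D))) ⟩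
        K ^ suc ι * (D ^ suc ι * D ^ suc ι) * (n * (D * D))
          ≡⟨ collect (K ^ suc ι) D n (D ^ suc ι) ⟩
        K ^ suc ι * n * E ∎

-- Counting edges and passing to large minimum degree

length-filterᵇ-tabulate : ∀ {X Y : Set} (p : Y → Bool) (f : X → Y) (g : Fin m → X) →
  length (filterᵇ p (map f (tabulate g))) ≡ sum λ j → ⟦ p (f (g j)) ⟧
length-filterᵇ-tabulate {zero} p f g = refl
length-filterᵇ-tabulate {suc m} p f g with p (f (g zero))
... | true = cong suc (length-filterᵇ-tabulate p f (g ∘ suc))
... | false = length-filterᵇ-tabulate p f (g ∘ suc)

length-filterᵇ-concatMap : ∀ {X Y : Set} (p : Y → Bool) (F : X → List Y) (g : Fin m → X) →
  length (filterᵇ p (concatMap F (tabulate g))) ≡ sum λ i → length (filterᵇ p (F (g i)))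
length-filterᵇ-concatMap {zero} p F g = refl
length-filterᵇ-concatMap {suc m} p F g = trans
  (cong length (filter-++ (T? ∘ p) (F (g zero)) (concatMap F (tabulate (g ∘ suc)))))
  (trans (length-++ (filterᵇ p (F (g zero))))
  (cong (length (filterᵇ p (F (g zero))) +_) (length-filterᵇ-concatMap p F (g ∘ suc))))

module MinimumDegree {n : ℕ} (G : Graph n) where
  private
    A : Fin n → Fin n → ℕ
    A a b = ⟦ adj G a b ⟧

  size : (Fin n → Bool) → ℕ
  size σ = sum λ a → ⟦ σ a ⟧

  volume : (Fin n → Bool) → ℕ
  volume σ = sum λ a → ⟦ σ a ⟧ * degree G σ a

  -- The volume sees each edge from both ends; this factor 2 is given away.
  edges≤volume : edges G ≤ volume (λ _ → true)
  edges≤volume = begin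
    edges G
      ≡⟨ length-filterᵇ-concatMap p (λ i → map (i ,_) (allFin n)) (λ i → i) ⟩
    (sum λ i → length (filterᵇ p (map (i ,_) (allFin n))))
      ≡⟨ sum-cong-≗ (λ i → length-filterᵇ-tabulate p (i ,_) (λ j → j)) ⟩
    (sum λ i → sum λ j → ⟦ (toℕ i <ᵇ toℕ j) ∧ adj G i j ⟧)
      ≤⟨ sum-mono (λ i → ≤-trans (sum-mono λ j → drop (toℕ i <ᵇ toℕ j) (adj G i j)) (≤-reflexive (≡-sym (+-identityʳ (degree G (λ _ → true) i))))) ⟩
    volume (λ _ → true) ∎
    where
    open ≤-Reasoning
    p : Fin n × Fin n → Bool
    p (i , j) = (toℕ i <ᵇ toℕ j) ∧ adj G i j
    drop : ∀ a b → ⟦ a ∧ b ⟧ ≤ ⟦ b ⟧ * 1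
    drop true b = ≤-reflexive (≡-sym (*-identityʳ ⟦ b ⟧))
    drop false b = z≤n

  remove : (Fin n → Bool) → Fin n → Fin n → Bool
  remove σ x a = σ a ∧ not (x == a)

  module _ (σ : Fin n → Bool) (x : Fin n) (x∈σ : σ x ≡ true) where
    private
      σ′ = remove σ x

    remove-indicator : ∀ a → ⟦ σ a ⟧ ≡ ⟦ σ′ a ⟧ + ⟦ x == a ⟧
    remove-indicator a with x == a in e
    ... | true rewrite ≡-sym (==⇒≡ x a e) | x∈σ = refl
    ... | false with σ a
    ...   | true = refl
    ...   | false = refl

    size-remove : size σ ≡ suc (size σ′)
    size-remove = begin
      size σ                                  ≡⟨ sum-cong-≗ remove-indicator ⟩
      (sum λ a → ⟦ σ′ a ⟧ + ⟦ x == a ⟧)       ≡⟨ ∑-distrib-+ (λ a → ⟦ σ′ a ⟧) (λ a → ⟦ x == a ⟧) ⟩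
      size σ′ + (sum λ a → ⟦ x == a ⟧)        ≡⟨ cong (size σ′ +_) (trans (sum-cong-≗ λ a → ≡-sym (+-identityʳ ⟦ x == a ⟧)) (sum-delta (λ _ → 1) x)) ⟩
      size σ′ + 1                             ≡⟨ +-comm (size σ′) 1 ⟩
      suc (size σ′)                           ∎
      where open ≡-Reasoning

    degree-remove : ∀ a → degree G σ a ≡ degree G σ′ a + A a x
    degree-remove a = begin
      (sum λ b → A a b * ⟦ σ b ⟧)                         ≡⟨ sum-cong-≗ (λ b → trans (cong (A a b *_) (remove-indicator b)) (*-distribˡ-+ (A a b) ⟦ σ′ b ⟧ ⟦ x == b ⟧)) ⟩
      (sum λ b → A a b * ⟦ σ′ b ⟧ + A a b * ⟦ x == b ⟧)   ≡⟨ ∑-distrib-+ (λ b → A a b * ⟦ σ′ b ⟧) (λ b → A a b * ⟦ x == b ⟧) ⟩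
      degree G σ′ a + (sum λ b → A a b * ⟦ x == b ⟧)        ≡⟨ cong (degree G σ′ a +_) (sum-delta (A a) x) ⟩
      degree G σ′ a + A a x                                 ∎
      where open ≡-Reasoning

    -- The removal of `x` costs its own degree and one for each of its neighbours.
    volume-remove : volume σ ≤ volume σ′ + 2 * degree G σ x
    volume-remove = begin
      (sum λ a → ⟦ σ a ⟧ * degree G σ a)
        ≡⟨ sum-cong-≗ (λ a → trans (cong (_* degree G σ a) (remove-indicator a)) (trans (*-distribʳ-+ (degree G σ a) ⟦ σ′ a ⟧ ⟦ x == a ⟧)
             (cong₂ _+_ (trans (cong (⟦ σ′ a ⟧ *_) (degree-remove a)) (*-distribˡ-+ ⟦ σ′ a ⟧ (degree G σ′ a) (A a x))) (*-comm ⟦ x == a ⟧ (degree G σ a))))) ⟩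
      (sum λ a → ⟦ σ′ a ⟧ * degree G σ′ a + ⟦ σ′ a ⟧ * A a x + degree G σ a * ⟦ x == a ⟧)
        ≡⟨ trans (∑-distrib-+ (λ a → ⟦ σ′ a ⟧ * degree G σ′ a + ⟦ σ′ a ⟧ * A a x) (λ a → degree G σ a * ⟦ x == a ⟧))
             (cong₂ _+_ (∑-distrib-+ (λ a → ⟦ σ′ a ⟧ * degree G σ′ a) (λ a → ⟦ σ′ a ⟧ * A a x)) (sum-delta (degree G σ) x)) ⟩
      volume σ′ + (sum λ a → ⟦ σ′ a ⟧ * A a x) + degree G σ x
        ≡⟨ cong (λ y → volume σ′ + y + degree G σ x) (sum-cong-≗ λ a → trans (*-comm ⟦ σ′ a ⟧ (A a x)) (cong (λ b → ⟦ b ⟧ * ⟦ σ′ a ⟧) (sym G a x))) ⟩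
      volume σ′ + degree G σ′ x + degree G σ x
        ≤⟨ +-monoˡ-≤ (degree G σ x) (+-monoʳ-≤ (volume σ′) (subst (degree G σ′ x ≤_) (≡-sym (degree-remove x)) (m≤m+n _ _))) ⟩
      volume σ′ + degree G σ x + degree G σ x
        ≡⟨ double (volume σ′) (degree G σ x) ⟩
      volume σ′ + 2 * degree G σ x ∎
      where
      open ≤-Reasoning
      double : ∀ v d → v + d + d ≡ v + 2 * d
      double = solve-∀

  -- Removing a vertex of degree at most `δ` lowers the volume by at most `2 * δ`, which is just
  -- what `2 * (δ * t)` loses, so the strict inequality survives. When no such vertex is left, the
  -- volume is still positive and exhibits a vertex of the set.
  dense-part : ∀ δ t σ → size σ ≡ t → 2 * (δ * t) < volume σ →
    ∃[ σ′ ] (∃[ a ] σ′ a ≡ true) × (∀ a → σ′ a ≡ true → δ < degree G σ′ a)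
  dense-part δ t σ size≡ big with any? (λ a → (σ a ≟ᵇ true) ×-dec (degree G σ a ≤? δ))
  dense-part δ t σ size≡ big | no all-large =
    σ , (let a , p = sum-positive (λ a → ⟦ σ a ⟧ * degree G σ a) (≤-<-trans z≤n big) in
         a , ⟦⟧-positive (proj₁ (*-positive ⟦ σ a ⟧ (degree G σ a) p))) ,
    λ a a∈σ → ≰⇒> λ small → all-large (a , a∈σ , small)
  dense-part δ zero σ size≡ big | yes (x , x∈σ , small) = contradiction (trans (≡-sym size≡) (size-remove σ x x∈σ)) λ ()
  dense-part δ (suc t) σ size≡ big | yes (x , x∈σ , small) =
    dense-part δ t (remove σ x) (suc-injective (trans (≡-sym (size-remove σ x x∈σ)) size≡))
      (+-cancelʳ-< (2 * δ) _ _ (begin-strict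
        2 * (δ * t) + 2 * δ                          ≡⟨ expand δ t ⟩
        2 * (δ * suc t)                              <⟨ big ⟩
        volume σ                                     ≤⟨ volume-remove σ x x∈σ ⟩
        volume (remove σ x) + 2 * degree G σ x         ≤⟨ +-monoʳ-≤ (volume (remove σ x)) (*-monoʳ-≤ 2 small) ⟩
        volume (remove σ x) + 2 * δ                  ∎))
    where
    open ≤-Reasoning
    expand : ∀ δ t → 2 * (δ * t) + 2 * δ ≡ 2 * (δ * (1 + t))
    expand = solve-∀

  degree≤n : ∀ σ a → degree G σ a ≤ n
  degree≤n σ a = ≤-trans (sum-mono λ b → *-mono-≤ (⟦⟧≤1 (adj G a b)) (⟦⟧≤1 (σ b)))
    (≤-reflexive (trans (sum-const n 1) (*-identityʳ n)))

-- Choice of weights and constants, and the conclusion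

∣! : ∀ d → d < n → suc d ∣ n !
∣! d d<n = ∣-trans (m∣m*n (d !)) (m≤n⇒m!∣n! d<n)

-- L exceeds 5 M², where M² counts the pairs of positions on the cycle; K dominates the factors of
-- first-step in the hypotheses of clash-bound.
module Constants (ι r : ℕ) where
  s M L c K : ℕ
  s = suc r
  M = 2 + (suc ι + suc ι)
  L = suc (M * (M * 5))
  c = L ^ s * (s * s)
  K = suc (L * L + L ^ s * (L ^ s * s) + c * c)

module _ (ι r : ℕ) (G : Graph n) where
  open Constants ι r
  open MinimumDegree G
  -- If `δ` were larger, every far pair would clash with probability at most 5 / L. Over the at most
  -- M² pairs this adds up to less than 1, whereas every closed walk of positive weight has a clash.
  minimum-degree-bound : ¬ ContainsKss s G → ¬ ContainsInducedCycle M G → ∀ δ .{{_ : NonZero δ}} σ a → σ a ≡ true →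
    (∀ a → σ a ≡ true → δ ≤ degree G σ a) → δ ^ (2 + ι) ≤ K ^ (2 + ι) * n
  minimum-degree-bound Kss-free cycle-free δ σ a a∈σ large = ≮⇒≥ λ huge → absurd (first-step-small K {{_}} {{D≢0}} ι huge)
    where
    -- Divisible by every degree that occurs on `σ`, as these lie between 1 and `n`; so D / degree
    -- is a natural number.
    D = n !
    D≢0 : NonZero D
    D≢0 = n !≢0
    weight : ∀ a → ∃[ x ] x * degree G σ a ≡ D * ⟦ σ a ⟧ × δ * x ≤ D * ⟦ σ a ⟧
    weight a with σ a in e
    ... | false = 0 , ≡-sym (*-zeroʳ D) , ≤-reflexive (trans (*-zeroʳ δ) (≡-sym (*-zeroʳ D)))
    ... | true with degree G σ a | large a e | degree≤n σ a
    ...   | zero | δ≤d | _ = contradiction δ≤d (<⇒≱ (>-nonZero⁻¹ δ))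
    ...   | suc d | δ≤d | d<n with ∣! d d<n
    ...     | divides x D≡ = x , trans (≡-sym D≡) (≡-sym (*-identityʳ D)) ,
              ≤-trans (*-monoˡ-≤ x δ≤d) (≤-reflexive (trans (*-comm (suc d) x) (trans (≡-sym D≡) (≡-sym (*-identityʳ D)))))
    w : Fin n → ℕ
    w a = proj₁ (weight a)
    V≢0 : NonZero (volume σ)
    V≢0 = >-nonZero (≤-trans (subst (λ b → 0 < ⟦ b ⟧ * degree G σ a) (≡-sym a∈σ)
      (≤-trans (>-nonZero⁻¹ δ) (≤-trans (large a a∈σ) (≤-reflexive (≡-sym (+-identityʳ _))))))
      (term≤sum (λ a → ⟦ σ a ⟧ * degree G σ a) a))
    open Balanced G w σ D δ (λ a → proj₁ (proj₂ (weight a))) (λ a → proj₂ (proj₂ (weight a)))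
    open Pinched G w
    open Bounds G w ι
    open ClosedWalks G w using (closed-bound)
    instance
      V≢0′ = V≢0
    absurd : ¬ K * first-step ι ≤ moment (suc ι)
    absurd KU≤T = <-irrefl refl (begin-strict
      M * (M * 5) * T₀           <⟨ m<n+m (M * (M * 5) * T₀) T₀>0 ⟩
      L * T₀                     ≡⟨ cong (L *_) (closed-+ (suc ι) (suc ι)) ⟨
      L * closed (suc (suc ι + suc ι)) ≤⟨ closed-bound (suc ι + suc ι) cycle-free L (5 * T₀) each ⟩
      M * (M * (5 * T₀))         ≡⟨ trans (cong (M *_) (≡-sym (*-assoc M 5 T₀))) (≡-sym (*-assoc M (M * 5) T₀)) ⟩
      M * (M * 5) * T₀           ∎)
      where
      open ≤-Reasoning
      T₀ = moment (suc ι)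
      U = first-step ι
      T₀>0 : 0 < T₀
      -- Positivity makes the final comparison of multiples of `T₀` strict; it comes from the top
      -- eigenvalue.
      T₀>0 = ≤-trans (>-nonZero⁻¹ _ {{m*n≢0 _ _ {{m^n≢0 D (2 + ι) {{D≢0}}}} {{m^n≢0 D (2 + ι) {{D≢0}}}}}}) (moment-lower (suc ι))
      below : ∀ x → x ≤ K → x * U ≤ T₀
      below x x≤K = ≤-trans (*-monoˡ-≤ U x≤K) KU≤T
      each : ∀ g q → 2 + (g + q) ≡ suc ι + suc ι → L * pinched (clash) (suc g) (suc q) ≤ 5 * T₀
      each g q e = clash-bound r Kss-free L
        (below (L * L) (m≤n⇒m≤1+n (m≤n⇒m≤n+o (c * c) (m≤m+n _ _))))
        (below (L ^ s * (L ^ s * s)) (m≤n⇒m≤1+n (m≤n⇒m≤n+o (c * c) (m≤n+m _ _))))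
        (below (c * c) (m≤n⇒m≤1+n (m≤n+m _ _)))
        g q (suc-injective (trans (suc-injective e) (+-suc ι ι)))

  average-degree-bound : ¬ ContainsKss s G → ¬ ContainsInducedCycle M G → ∀ δ → 2 * (δ * n) < edges G →
    suc δ ^ (2 + ι) ≤ K ^ (2 + ι) * n
  average-degree-bound Kss-free cycle-free δ many
    with dense-part δ n (λ _ → true) (trans (sum-const n 1) (*-identityʳ n)) (<-≤-trans many edges≤volume)
  ... | σ , (a , a∈σ) , large = minimum-degree-bound Kss-free cycle-free (suc δ) σ a a∈σ large

-- The largest usable δ is about e / (2n). In the 4, one factor 2 comes from the threshold
-- `2 * (δ * n)` and the other absorbs the rounding.
edges-bound : ∀ k K n e .{{_ : NonZero K}} .{{_ : NonZero n}} → (∀ δ → 2 * (δ * n) < e → suc δ ^ k ≤ K ^ k * n) →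
  e ^ k ≤ (4 * K) ^ k * n ^ (k + 1)
edges-bound k K n e bound = conclude (e / (2 * n)) refl
  where
  open ≤-Reasoning
  instance
    2n≢0 : NonZero (2 * n)
    2n≢0 = m*n≢0 2 n
  from : ∀ p → e ≤ 4 * n * p → p ^ k ≤ K ^ k * n → e ^ k ≤ (4 * K) ^ k * n ^ (k + 1)
  from p e≤ p≤ = begin
    e ^ k                            ≤⟨ ^-monoˡ-≤ k e≤ ⟩
    (4 * n * p) ^ k                  ≡⟨ trans (^-distribʳ-* k (4 * n) p) (cong (_* p ^ k) (^-distribʳ-* k 4 n)) ⟩
    4 ^ k * n ^ k * p ^ k            ≤⟨ *-monoʳ-≤ (4 ^ k * n ^ k) p≤ ⟩
    4 ^ k * n ^ k * (K ^ k * n)      ≡⟨ arrange (4 ^ k) (n ^ k) (K ^ k) n ⟩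
    4 ^ k * K ^ k * (n ^ k * (n * 1)) ≡⟨ cong₂ _*_ (^-distribʳ-* k 4 K) (^-distribˡ-+-* n k 1) ⟨
    (4 * K) ^ k * n ^ (k + 1)        ∎
    where
    arrange : ∀ p q r n → p * q * (r * n) ≡ p * r * (q * (n * 1))
    arrange = solve-∀
  division : ∀ q → e / (2 * n) ≡ q → e < 2 * n + q * (2 * n)
  division q refl = subst (_< 2 * n + q * (2 * n)) (≡-sym (m≡m%n+[m/n]*n e (2 * n))) (+-monoˡ-< (q * (2 * n)) (m%n<n e (2 * n)))
  conclude : ∀ q → e / (2 * n) ≡ q → e ^ k ≤ (4 * K) ^ k * n ^ (k + 1)
  -- Here `e` is below `2 * n` and no degree information is needed: 1 takes the place of `suc δ`.
  conclude zero q≡ = from 1 (≤-trans (<⇒≤ (division 0 q≡)) (subst (2 * n + 0 ≤_) (spread n) (+-monoʳ-≤ (2 * n) z≤n)))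
    (subst (_≤ K ^ k * n) (≡-sym (^-zeroˡ k)) (>-nonZero⁻¹ _ {{m*n≢0 (K ^ k) n {{m^n≢0 K k}}}}))
    where
    spread : ∀ n → 2 * n + 2 * n ≡ 4 * n * 1
    spread = solve-∀
  -- One less than the quotient, so that `2 * (δ * n)` is strictly below `e`; still e < 2n (δ + 2) ≤
  -- 4n (δ + 1).
  conclude (suc δ) q≡ = from (suc δ) (≤-trans (<⇒≤ (division (suc δ) q≡)) (subst (2 * n + suc δ * (2 * n) ≤_) (spread n δ) (m≤m+n _ (δ * (2 * n)))))
    (bound δ (begin-strict
      2 * (δ * n)                       ≡⟨ swap δ n ⟩
      δ * (2 * n)                       <⟨ m<n+m (δ * (2 * n)) (>-nonZero⁻¹ (2 * n)) ⟩
      suc δ * (2 * n)                   ≤⟨ m≤n+m _ (e % (2 * n)) ⟩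
      e % (2 * n) + suc δ * (2 * n)     ≡⟨ cong (λ q → e % (2 * n) + q * (2 * n)) q≡ ⟨
      e % (2 * n) + e / (2 * n) * (2 * n) ≡⟨ m≡m%n+[m/n]*n e (2 * n) ⟨
      e                                 ∎))
    where
    swap : ∀ δ n → 2 * (δ * n) ≡ δ * (2 * n)
    swap = solve-∀
    spread : ∀ n δ → 2 * n + (2 * n + δ * (2 * n)) + δ * (2 * n) ≡ 4 * n * (1 + δ)
    spread = solve-∀

theorem1p4 : (k s : ℕ) → 2 ≤ k → 2 ≤ s →
    ∃[ C ] ((n : ℕ) → 1 ≤ n → (G : Graph n) →
    ¬ ContainsKss s G → ¬ ContainsInducedCycle (2 * k) G →
    edges G ^ k ≤ C ^ k * n ^ (k + 1))
-- With k = ι + 2, walks of length k have `suc ι` interior vertices. Raising to the k-th power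
-- clears the exponent 1 + 1/k, and `K` depends on `ι` and `r` alone.
theorem1p4 (suc (suc ι)) (suc r) (s≤s (s≤s z≤n)) _ = 4 * K , λ n 1≤n G Kss-free cycle-free →
  edges-bound (2 + ι) K n (edges G) {{_}} {{>-nonZero 1≤n}}
    (average-degree-bound ι r G Kss-free (cycle-free ∘ subst (λ m → ContainsInducedCycle m G) (length≡ ι)))
  where
  open Constants ι r
  length≡ : ∀ ι → 2 + (suc ι + suc ι) ≡ 2 * (2 + ι)
  length≡ ι = cong (2 +_) (trans (cong (λ x → suc (ι + suc x)) (≡-sym (+-identityʳ ι))) (≡-sym (+-suc ι (suc (ι + 0)))))
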